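{- For $g \geq 2$, let $f_{g,e}$ denote the number of isomorphism classes of genus $g$ combinatorial types $(G,w)$ with $|E(G)| = e$. Then: (i) there are $42$ isomorphism classes of genus $3$ combinatorial types, and $(f_{3,0},\dots,f_{3,6}) = (1,2,5,9,12,8,5)$; (ii) there are $379$ isomorphism classes of genus $4$ combinatorial types, and $(f_{4,0},\dots,f_{4,9}) = (1,3,7,21,43,75,89,81,42,17)$; (iii) there are $4555$ isomorphism classes of genus $5$ combinatorial types, and $(f_{5,0},\dots,f_{5,12}) = (1,3,11,34,100,239,492,784,1002,926,632,260,71)$.
   Context: A combinatorial type is a pair $(G,w)$ where $G$ is a finite connected graph (loops and parallel edges allowed) and $w: V(G) \to \mathbb{Z}_{\geq 0}$ is a vertex weight function such that every vertex of weight $0$ has degree at least $3$. Its genus is $|E(G)|-|V(G)|+1+\sum_{v \in V(G)} w(v)$. Two combinatorial types are isomorphic if there is a graph isomorphism between them preserving vertex weights. (These isomorphism classes are the cells of the moduli space $M^{\mathrm{tr}}_g$ of tropical curves, the cell of $(G,w)$ having dimension $|E(G)|$.) -}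

module Defs where

open import Data.Nat using (ℕ; zero; suc; _+_; _≤_)
open import Data.Fin using (Fin; toℕ)
open import Data.Product using (Σ; _×_; _,_; proj₁; proj₂; ∃)
open import Data.Sum using (_⊎_)
open import Data.Vec using (Vec; lookup)
open import Data.Bool using (if_then_else_)
open import Relation.Nullary using (does)
open import Relation.Binary.PropositionalEquality using (_≡_)
open import Function.Bundles using (_↔_; Inverse)
import Data.Fin as F

∑ : (n : ℕ) → (Fin n → ℕ) → ℕ
∑ zero f = 0
∑ (suc n) f = f Fin.zero + ∑ n (λ i → f (Fin.suc i))

-- A vertex-weighted multigraph (loops and parallel edges allowed):
-- vertices Fin nV, edges Fin nE, each edge has two endpoints
-- (the order of the endpoints is irrelevant: isomorphisms may flip it),
-- and a weight function on vertices.
record WGraph : Set where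
  field
    nV   : ℕ
    nE   : ℕ
    ends : Fin nE → Fin nV × Fin nV
    w    : Fin nV → ℕ
open WGraph public

degree : (G : WGraph) → Fin (nV G) → ℕ
degree G v = ∑ (nE G) (λ e →
  (if does (proj₁ (ends G e) F.≟ v) then 1 else 0) +
  (if does (proj₂ (ends G e) F.≟ v) then 1 else 0))

data Reach (G : WGraph) : Fin (nV G) → Fin (nV G) → Set where
  here : ∀ {u} → Reach G u u
  fwd  : ∀ {u} (e : Fin (nE G)) →
         Reach G (proj₂ (ends G e)) u → Reach G (proj₁ (ends G e)) u
  bwd  : ∀ {u} (e : Fin (nE G)) →
         Reach G (proj₁ (ends G e)) u → Reach G (proj₂ (ends G e)) u

Connected : WGraph → Set
Connected G = (1 ≤ nV G) × (∀ u v → Reach G u v)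

IsCombType : WGraph → Set
IsCombType G = Connected G × (∀ v → w G v ≡ 0 → 3 ≤ degree G v)

-- genus |E| - |V| + 1 + Σ w  equals g  (stated additively in ℕ)
HasGenus : WGraph → ℕ → Set
HasGenus G g = nE G + 1 + ∑ (nV G) (w G) ≡ g + nV G

SameEnds : ∀ {n} → Fin n × Fin n → Fin n × Fin n → Set
SameEnds (a , b) (c , d) = ((a ≡ c) × (b ≡ d)) ⊎ ((a ≡ d) × (b ≡ c))

Iso : WGraph → WGraph → Set
Iso G H =
  Σ (Fin (nV G) ↔ Fin (nV H)) λ σ →
  Σ (Fin (nE G) ↔ Fin (nE H)) λ τ →
    (∀ e → SameEnds (ends H (Inverse.to τ e))
                    (Inverse.to σ (proj₁ (ends G e)) , Inverse.to σ (proj₂ (ends G e))))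
    × (∀ v → w H (Inverse.to σ v) ≡ w G v)

NumIsoClasses : (WGraph → Set) → ℕ → Set
NumIsoClasses P k =
  Σ (Fin k → WGraph) λ rep →
    (∀ i → P (rep i))
    × (∀ i j → Iso (rep i) (rep j) → i ≡ j)
    × (∀ G → P G → ∃ λ i → Iso G (rep i))

TypeOfGenus : ℕ → WGraph → Set
TypeOfGenus g G = IsCombType G × HasGenus G g

TypeOfGenusEdges : ℕ → ℕ → WGraph → Set
TypeOfGenusEdges g e G = TypeOfGenus g G × (nE G ≡ e)

Counts : ℕ → ℕ → (m : ℕ) → Vec ℕ m → Set
Counts g total m fs =
  NumIsoClasses (TypeOfGenus g) total
  × (∀ (e : Fin m) → NumIsoClasses (TypeOfGenusEdges g (toℕ e)) (lookup fs e))

{-# OPTIONS --safe #-}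
module Submission where

-- A type is stored as its weights together with its adjacency matrix, a loop counting 2 on the diagonal, so that
-- the row sums are the degrees.  Contracting all loops turns each of them into a unit of weight.  In a loopless
-- type the charge 2 w(v) + deg(v) of every vertex is at least 3 and the charges sum to 2g - 2 + 2|V|.  Merging a
-- vertex v of least charge with a neighbour u gives a loopless type of the same genus with one vertex fewer,
-- where the charge of the merged vertex is the sum of the two minus 2.  Hence, starting from one vertex of
-- weight g, every loopless type arises by repeatedly splitting a vertex, and there are few splittings to try: v
-- carries the least charge, and u can be taken of least charge among the neighbours of v.  All types
-- are obtained from the loopless ones by trading weight for loops.
--
-- Duplicates are removed by relabelling every table; any relabelling is sound, and a good one makes
-- isomorphic types equal.  That the remaining types are pairwise not isomorphic follows from an invariant
-- (a hash from colour refinement with one distinguished vertex), which takes distinct values on them.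

open import Defs
import Algebra.Properties.Semiring.Sum
open import Data.Nat
open import Data.Nat.Properties
open import Data.Nat.Induction using (<-wellFounded)
open import Data.Nat.Tactic.RingSolver using (solve-∀)
open import Data.Bool using (Bool; true; false; if_then_else_; _∧_; T?)
import Data.Bool as Bool
import Data.Bool.Properties as Bool
open import Data.Fin as Fin using (Fin; zero; suc; toℕ; punchIn)
import Data.Fin.Properties as Fin
open import Data.Fin.Permutation as Perm using (Permutation; _⟨$⟩ʳ_; _⟨$⟩ˡ_; inverseʳ; inverseˡ)
open import Data.List as List using (List; []; _∷_; _++_)
open import Data.List.Relation.Unary.Any as Any using (Any; here; there)
import Data.List.Relation.Unary.Any.Properties as Any
open import Data.List.Relation.Unary.All as All using (All)
open import Data.List.Relation.Unary.AllPairs as AllPairs using (AllPairs; []; _∷_)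
import Data.List.Relation.Unary.AllPairs.Properties as AllPairs
open import Data.List.Relation.Unary.Linked using (linked?)
open import Data.List.Relation.Unary.Linked.Properties using (Linked⇒AllPairs)
open import Data.List.Membership.Propositional using (_∈_; lose; find)
open import Data.List.Membership.Propositional.Properties using (∈-upTo⁺; ∈-map⁺; ∈-allFin; ∈-filter⁺; ∈-filter⁻; ∈-lookup)
open import Data.Product using (Σ; ∃; _×_; _,_; proj₁; proj₂)
open import Data.Sum using (_⊎_; inj₁; inj₂)
open import Data.Vec as Vec using (Vec; []; _∷_; lookup; tabulate; updateAt; allFin)
import Data.Vec.Properties as Vec
open import Data.Unit using (⊤)
open import Function using (_∘_; Inverse; Equivalence)
open import Function.Strict using (force′; force′-≡)
open import Relation.Nullary using (¬_; Dec; does; yes; no; contradiction)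
open import Relation.Nullary.Decidable using (dec-true; dec-false; _×-dec_; _⊎-dec_; map′)
open import Induction.WellFounded using (Acc; acc)
open import Relation.Binary.Construct.Closure.ReflexiveTransitive as Star using (Star; ε; _◅_; _◅◅_)
open import Relation.Binary.Definitions using (tri<; tri≈; tri>)
open import Relation.Binary.PropositionalEquality

open Algebra.Properties.Semiring.Sum +-*-semiring
  using (sum; sum-cong-≗; ∑-distrib-+; ∑-comm; sum-permute; sum-remove; *-distribˡ-sum)

private variable
  m n o : ℕ

-- Finite sums, the Kronecker delta and permutations.

∑≡sum : ∀ n (f : Fin n → ℕ) → ∑ n f ≡ sum f
∑≡sum zero f = refl
∑≡sum (suc n) f = cong (f zero +_) (∑≡sum n (f ∘ suc))

sum-zero : ∀ (f : Fin n → ℕ) → (∀ i → f i ≡ 0) → sum f ≡ 0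
sum-zero {zero} f eq = refl
sum-zero {suc n} f eq = cong₂ _+_ (eq zero) (sum-zero (f ∘ suc) (eq ∘ suc))

term≤sum : ∀ (f : Fin n → ℕ) i → f i ≤ sum f
term≤sum {suc n} f zero = m≤m+n _ _
term≤sum {suc n} f (suc i) = ≤-trans (term≤sum (f ∘ suc) i) (m≤n+m _ _)

sum>0⇒∃ : ∀ (f : Fin n → ℕ) → 0 < sum f → ∃ λ i → 0 < f i
sum>0⇒∃ {suc n} f pos with f zero in eq
... | suc k = zero , subst (0 <_) (sym eq) z<s
... | zero with sum>0⇒∃ (f ∘ suc) pos
...   | i , p = suc i , p

-- Taking out the term at `u` leaves equal sums. The additive form avoids truncated subtraction.
sum-differ-at : ∀ (u : Fin n) (f g : Fin n → ℕ) → (∀ i → i ≢ u → f i ≡ g i) →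
                sum f + g u ≡ sum g + f u
sum-differ-at {suc n} u f g eq = begin
  sum f + g u                          ≡⟨ cong (_+ g u) (sum-remove f) ⟩
  f u + sum (f ∘ punchIn u) + g u      ≡⟨ cong (λ s → f u + s + g u) (sum-cong-≗ λ j → eq (punchIn u j) (Fin.punchInᵢ≢i u j)) ⟩
  f u + sum (g ∘ punchIn u) + g u      ≡⟨ rotate (f u) (sum (g ∘ punchIn u)) (g u) ⟩
  g u + sum (g ∘ punchIn u) + f u      ≡⟨ cong (_+ f u) (sum-remove g) ⟨
  sum g + f u                          ∎
  where
  open ≡-Reasoning
  rotate : ∀ a s b → a + s + b ≡ b + s + a
  rotate = solve-∀

δ : Fin n → Fin n → ℕ
δ a b = if does (a Fin.≟ b) then 1 else 0

δ-same : ∀ (a : Fin n) → δ a a ≡ 1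
δ-same a = cong (if_then 1 else 0) (dec-true (a Fin.≟ a) refl)

δ-distinct : ∀ {a b : Fin n} → a ≢ b → δ a b ≡ 0
δ-distinct {a = a} {b} a≢b = cong (if_then 1 else 0) (dec-false (a Fin.≟ b) a≢b)

δ>0⇒≡ : ∀ (a b : Fin n) → 0 < δ a b → a ≡ b
δ>0⇒≡ a b pos with a Fin.≟ b
... | yes a≡b = a≡b

δ-sym : ∀ (a b : Fin n) → δ a b ≡ δ b a
δ-sym a b with a Fin.≟ b
... | yes refl = sym (δ-same a)
... | no a≢b = sym (δ-distinct (a≢b ∘ sym))

permute-injective : ∀ (π : Permutation m n) {a b} → π ⟨$⟩ʳ a ≡ π ⟨$⟩ʳ b → a ≡ b
permute-injective π eq = trans (sym (inverseˡ π)) (trans (cong (π ⟨$⟩ˡ_) eq) (inverseˡ π))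

δ-permute : ∀ (π : Permutation m n) a b → δ (π ⟨$⟩ʳ a) (π ⟨$⟩ʳ b) ≡ δ a b
δ-permute π a b with a Fin.≟ b
... | yes refl = δ-same (π ⟨$⟩ʳ a)
... | no a≢b = δ-distinct (a≢b ∘ permute-injective π)

sum-δ : ∀ (a : Fin n) (f : Fin n → ℕ) → sum (λ i → δ a i * f i) ≡ f a
sum-δ {n} a f = begin
  sum (λ i → δ a i * f i)       ≡⟨ +-identityʳ _ ⟨
  sum (λ i → δ a i * f i) + 0   ≡⟨ sum-differ-at a (λ i → δ a i * f i) none (λ i i≢a → cong (_* f i) (δ-distinct (i≢a ∘ sym))) ⟩
  sum none + δ a a * f a        ≡⟨ cong₂ _+_ (sum-zero none (λ _ → refl)) (cong (_* f a) (δ-same a)) ⟩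
  1 * f a                       ≡⟨ *-identityˡ (f a) ⟩
  f a                           ∎
  where
  open ≡-Reasoning
  none : Fin n → ℕ
  none _ = 0

-- Weighted adjacency matrices, their isomorphisms and admissibility.

record Graph (n : ℕ) : Set where
  constructor graph
  field
    weight : Fin n → ℕ
    adj    : Fin n → Fin n → ℕ

  -- Two more than the coefficient of the vertex in the canonical divisor of the weighted graph,
  -- which is `2w - 2 + deg`.
  charge : Fin n → ℕ
  charge i = 2 * weight i + sum (adj i)

open Graph

infix 4 _≅_

record _≅_ (G : Graph m) (H : Graph n) : Set where
  constructor iso
  field
    perm    : Permutation m n
    weight≡ : ∀ i → weight H (perm ⟨$⟩ʳ i) ≡ weight G i
    adj≡    : ∀ i j → adj H (perm ⟨$⟩ʳ i) (perm ⟨$⟩ʳ j) ≡ adj G i j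

open _≅_

≅-sym : ∀ {G : Graph m} {H : Graph n} → G ≅ H → H ≅ G
≅-sym {G = G} {H} (iso π weq aeq) = iso (Perm.flip π)
  (λ i → trans (sym (weq _)) (cong (weight H) (inverseʳ π)))
  (λ i j → trans (sym (aeq _ _)) (cong₂ (adj H) (inverseʳ π) (inverseʳ π)))

≅-trans : ∀ {G : Graph m} {H : Graph n} {K : Graph o} → G ≅ H → H ≅ K → G ≅ K
≅-trans (iso π weq aeq) (iso ρ weq′ aeq′) = iso (π Perm.∘ₚ ρ)
  (λ i → trans (weq′ _) (weq i)) (λ i j → trans (aeq′ _ _) (aeq i j))

≗⇒≅ : ∀ {G H : Graph n} → (∀ i → weight H i ≡ weight G i) → (∀ i j → adj H i j ≡ adj G i j) → G ≅ H
≗⇒≅ = iso Perm.id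

reindex : Permutation m n → Graph n → Graph m
reindex π G = graph (λ i → weight G (π ⟨$⟩ʳ i)) (λ i j → adj G (π ⟨$⟩ʳ i) (π ⟨$⟩ʳ j))

reindex-≅ : ∀ (π : Permutation m n) (G : Graph n) → reindex π G ≅ G
reindex-≅ π G = iso π (λ _ → refl) (λ _ _ → refl)

charge≡ : ∀ {G : Graph m} {H : Graph n} (G≅H : G ≅ H) i → charge H (perm G≅H ⟨$⟩ʳ i) ≡ charge G i
charge≡ {H = H} (iso π weq aeq) i = cong₂ _+_ (cong (2 *_) (weq i))
  (trans (sum-permute (adj H _) π) (sum-cong-≗ (aeq i)))

Adjacent : Graph n → Fin n → Fin n → Set
Adjacent G i j = 0 < adj G i j

-- Steps whose two ends `f` identifies are dropped from the path. This keeps connectedness both when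
-- an edge is contracted and, with `f` the identity, when loops are removed.
Star-collapse : ∀ {R : Fin m → Fin m → Set} {S : Fin n → Fin n → Set} (f : Fin m → Fin n) →
  (∀ i j → R i j → f i ≢ f j → S (f i) (f j)) → ∀ {i j} → Star R i j → Star S (f i) (f j)
Star-collapse f step ε = ε
Star-collapse {S = S} f step {i} {j} (_◅_ {j = k} i~k path) with f i Fin.≟ f k
... | yes eq = subst (λ x → Star S x (f j)) (sym eq) (Star-collapse f step path)
... | no fi≢fk = step i k i~k fi≢fk ◅ Star-collapse f step path

-- Stability and genus are both phrased through charges: by the handshake lemma the charges add up
-- to `2|E| + 2Σw`, so the last field is the genus formula, doubled and without subtraction.
record Admissible (g : ℕ) (G : Graph n) : Set where
  field
    symmetric : ∀ i j → adj G i j ≡ adj G j i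
    connected : ∀ i j → Star (Adjacent G) i j
    charge≥3  : ∀ i → 3 ≤ charge G i
    genus     : sum (charge G) + 2 ≡ 2 * g + 2 * n

open Admissible

Loopless : Graph n → Set
Loopless G = ∀ i → adj G i i ≡ 0

admissible-≅ : ∀ {g} {G : Graph m} {H : Graph n} → G ≅ H → Admissible g G → Admissible g H
admissible-≅ {m} {n} {g} {G} {H} G≅H@(iso π _ aeq) good = record
  { symmetric = λ i j → trans (sym (aeq′ i j)) (trans (symmetric good _ _) (aeq′ j i))
  ; connected = λ i j → subst₂ (Star (Adjacent H)) (inverseʳ π) (inverseʳ π)
                          (Star.gmap (π ⟨$⟩ʳ_) (subst (0 <_) (sym (aeq _ _))) (connected good (π ⟨$⟩ˡ i) (π ⟨$⟩ˡ j)))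
  ; charge≥3 = λ i → subst (3 ≤_) (charge≡ (≅-sym G≅H) i) (charge≥3 good (π ⟨$⟩ˡ i))
  ; genus = subst (λ k → sum (charge H) + 2 ≡ 2 * g + 2 * k) (Perm.↔⇒≡ π)
              (trans (cong (_+ 2) (trans (sum-permute (charge H) π) (sum-cong-≗ (charge≡ G≅H)))) (genus good))
  }
  where aeq′ = adj≡ (≅-sym G≅H)

loopless-≅ : ∀ {G : Graph m} {H : Graph n} → G ≅ H → Loopless G → Loopless H
loopless-≅ G≅H ll i = trans (sym (adj≡ (≅-sym G≅H) i i)) (ll _)

-- From multigraphs to adjacency matrices and back along isomorphisms.

joins : Fin n × Fin n → Fin n → Fin n → ℕ
joins (a , b) u v = δ a u * δ b v + δ b u * δ a v

joins-sym : ∀ (p : Fin n × Fin n) u v → joins p u v ≡ joins p v u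
joins-sym (a , b) u v = swapped (δ a u) (δ b v) (δ b u) (δ a v)
  where
  swapped : ∀ x y z t → x * y + z * t ≡ t * z + y * x
  swapped = solve-∀

joins-cong : ∀ (p q : Fin n × Fin n) → SameEnds p q → ∀ u v → joins p u v ≡ joins q u v
joins-cong (a , b) _ (inj₁ (refl , refl)) u v = refl
joins-cong (a , b) _ (inj₂ (refl , refl)) u v = +-comm (δ a u * δ b v) (δ b u * δ a v)

joins-self : ∀ (p : Fin n × Fin n) → 0 < joins p (proj₁ p) (proj₂ p)
joins-self (a , b) rewrite δ-same a | δ-same b = z<s

joins>0⇒SameEnds : ∀ (p : Fin n × Fin n) u v → 0 < joins p u v → SameEnds p (u , v)
joins>0⇒SameEnds (a , b) u v pos with δ a u * δ b v in eq
... | suc _ = inj₁ (both a u b v (subst (0 <_) (sym eq) z<s))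
  where
  both : ∀ (a u b v : Fin _) → 0 < δ a u * δ b v → (a ≡ u) × (b ≡ v)
  both a u b v pos with a Fin.≟ u
  ... | yes a≡u = a≡u , δ>0⇒≡ b v (subst (0 <_) (*-identityˡ (δ b v)) pos)
... | zero with b Fin.≟ u
...   | yes b≡u = inj₂ (δ>0⇒≡ a v (subst (0 <_) (*-identityˡ (δ a v)) pos) , b≡u)

joins-permute : ∀ (π : Permutation m n) (p : Fin m × Fin m) u v →
  joins (π ⟨$⟩ʳ proj₁ p , π ⟨$⟩ʳ proj₂ p) (π ⟨$⟩ʳ u) (π ⟨$⟩ʳ v) ≡ joins p u v
joins-permute π (a , b) u v = cong₂ _+_ (cong₂ _*_ (δ-permute π a u) (δ-permute π b v))
                                        (cong₂ _*_ (δ-permute π b u) (δ-permute π a v))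

sum-joins : ∀ (p : Fin n × Fin n) u → sum (joins p u) ≡ δ (proj₁ p) u + δ (proj₂ p) u
sum-joins (a , b) u = begin
  sum (λ v → δ a u * δ b v + δ b u * δ a v)                 ≡⟨ sum-cong-≗ (λ v → cong₂ _+_ (*-comm (δ a u) (δ b v)) (*-comm (δ b u) (δ a v))) ⟩
  sum (λ v → δ b v * δ a u + δ a v * δ b u)                 ≡⟨ ∑-distrib-+ (λ v → δ b v * δ a u) (λ v → δ a v * δ b u) ⟩
  sum (λ v → δ b v * δ a u) + sum (λ v → δ a v * δ b u)     ≡⟨ cong₂ _+_ (sum-δ b (λ _ → δ a u)) (sum-δ a (λ _ → δ b u)) ⟩
  δ a u + δ b u                                             ∎
  where open ≡-Reasoning

-- A loop contributes 2 to the diagonal, so the row sums are the degrees.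
graphOf : (G : WGraph) → Graph (nV G)
graphOf G = graph (w G) (λ u v → sum (λ e → joins (ends G e) u v))

degree≡sum : ∀ G v → degree G v ≡ sum (adj (graphOf G) v)
degree≡sum G v = begin
  degree G v                                                     ≡⟨ ∑≡sum (nE G) _ ⟩
  sum (λ e → δ (proj₁ (ends G e)) v + δ (proj₂ (ends G e)) v)    ≡⟨ sum-cong-≗ (λ e → sum-joins (ends G e) v) ⟨
  sum (λ e → sum (joins (ends G e) v))                           ≡⟨ ∑-comm (λ e → joins (ends G e) v) ⟩
  sum (λ u → sum (λ e → joins (ends G e) v u))                   ∎
  where open ≡-Reasoning

handshake : ∀ G → sum (λ v → sum (adj (graphOf G) v)) ≡ 2 * nE G
handshake G = begin
  sum (λ v → sum (adj (graphOf G) v))                               ≡⟨ sum-cong-≗ (λ v → trans (sym (degree≡sum G v)) (∑≡sum (nE G) _)) ⟩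
  sum (λ v → sum (λ e → δ (proj₁ (ends G e)) v + δ (proj₂ (ends G e)) v)) ≡⟨ ∑-comm (λ v e → δ (proj₁ (ends G e)) v + δ (proj₂ (ends G e)) v) ⟩
  sum (λ e → sum (λ v → δ (proj₁ (ends G e)) v + δ (proj₂ (ends G e)) v)) ≡⟨ sum-cong-≗ (λ e → trans (∑-distrib-+ (δ (proj₁ (ends G e))) (δ (proj₂ (ends G e)))) (cong₂ _+_ (sum-δ1 (proj₁ (ends G e))) (sum-δ1 (proj₂ (ends G e))))) ⟩
  sum {nE G} (λ _ → 2)                                                    ≡⟨ sum-twos (nE G) ⟩
  2 * nE G                                                                ∎
  where
  open ≡-Reasoning
  sum-δ1 : ∀ (a : Fin n) → sum (δ a) ≡ 1
  sum-δ1 a = trans (sum-cong-≗ (λ v → sym (*-identityʳ (δ a v)))) (sum-δ a (λ _ → 1))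
  sum-twos : ∀ k → sum {k} (λ _ → 2) ≡ 2 * k
  sum-twos zero = refl
  sum-twos (suc k) = trans (cong (2 +_) (sum-twos k)) (sym (*-suc 2 k))

sum-charge : ∀ (G : Graph n) → sum (charge G) ≡ 2 * sum (weight G) + sum (λ v → sum (adj G v))
sum-charge G = trans (∑-distrib-+ (λ v → 2 * weight G v) (λ v → sum (adj G v)))
                     (cong (_+ sum (λ v → sum (adj G v))) (sym (*-distribˡ-sum 2 (weight G))))

sum-charge-graphOf : ∀ G → sum (charge (graphOf G)) + 2 ≡ 2 * (nE G + 1 + ∑ (nV G) (w G))
sum-charge-graphOf G = begin
  sum (charge (graphOf G)) + 2           ≡⟨ cong (_+ 2) (trans (sum-charge (graphOf G)) (cong (2 * sum (w G) +_) (handshake G))) ⟩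
  2 * sum (w G) + 2 * nE G + 2           ≡⟨ collect (sum (w G)) (nE G) ⟩
  2 * (nE G + 1 + sum (w G))             ≡⟨ cong (λ s → 2 * (nE G + 1 + s)) (∑≡sum (nV G) (w G)) ⟨
  2 * (nE G + 1 + ∑ (nV G) (w G))        ∎
  where
  open ≡-Reasoning
  collect : ∀ a b → 2 * a + 2 * b + 2 ≡ 2 * (b + 1 + a)
  collect = solve-∀

Reach⇒Star : ∀ G {u v} → Reach G u v → Star (Adjacent (graphOf G)) u v
Reach⇒Star G here = ε
Reach⇒Star G (fwd e r) =
  ≤-trans (joins-self (ends G e)) (term≤sum (λ e → joins (ends G e) _ _) e) ◅ Reach⇒Star G r
Reach⇒Star G (bwd e r) =
  ≤-trans (subst (0 <_) (joins-sym (ends G e) _ _) (joins-self (ends G e))) (term≤sum (λ e → joins (ends G e) _ _) e) ◅ Reach⇒Star G r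

Star⇒Reach : ∀ G {u v} → Star (Adjacent (graphOf G)) u v → Reach G u v
Star⇒Reach G ε = here
Star⇒Reach G {u} (_◅_ {j = v} uv p) with sum>0⇒∃ (λ e → joins (ends G e) u v) uv
... | e , pos = step (joins>0⇒SameEnds (ends G e) u v pos) (Star⇒Reach G p)
  where
  step : ∀ {u v x} → SameEnds (ends G e) (u , v) → Reach G v x → Reach G u x
  step (inj₁ (refl , refl)) = fwd e
  step (inj₂ (refl , refl)) = bwd e

neighbour : ∀ (G : Graph (suc (suc n))) → (∀ i j → Star (Adjacent G) i j) → ∀ v → ∃ (Adjacent G v)
neighbour G conn v = first-step (conn v (punchIn v zero)) (Fin.punchInᵢ≢i v zero ∘ sym)
  where
  first-step : ∀ {i j} → Star (Adjacent G) i j → i ≢ j → ∃ (Adjacent G i)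
  first-step ε i≢i = contradiction refl i≢i
  first-step (ij ◅ _) _ = _ , ij

-- Stability speaks of weight 0 only. Weight 2 or more already gives charge 4; a vertex of weight 1
-- has a neighbour when there are at least two vertices; a single vertex has charge `2g` by the
-- genus equation, hence at least 4.
charge≥3-criterion : ∀ {g} → 2 ≤ g → (G : Graph n) → (∀ i j → Star (Adjacent G) i j) →
  sum (charge G) + 2 ≡ 2 * g + 2 * n → ∀ v → (weight G v ≡ 0 → 3 ≤ sum (adj G v)) → 3 ≤ charge G v
charge≥3-criterion {suc zero} {g} 2≤g G conn gen zero _ =
  subst (3 ≤_) (sym (trans (sym (+-identityʳ _)) (+-cancelʳ-≡ 2 _ _ gen)))
    (≤-trans (n≤1+n 3) (*-monoʳ-≤ 2 2≤g))
charge≥3-criterion {suc (suc n)} 2≤g G conn gen v stable with weight G v | neighbour G conn v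
... | 0 | _ = stable refl
... | 1 | u , vu = s≤s (s≤s (≤-trans vu (term≤sum (adj G v) u)))
... | suc (suc a) | _ = ≤-trans (≤-trans (n≤1+n 3) (*-monoʳ-≤ 2 (s≤s (s≤s (z≤n {a}))))) (m≤m+n _ _)

typeOfGenus⇒admissible : ∀ {g} → 2 ≤ g → ∀ G → TypeOfGenus g G → Admissible g (graphOf G)
typeOfGenus⇒admissible {g} 2≤g G (((_ , conn) , stable) , gen) = record
  { symmetric = λ u v → sum-cong-≗ (λ e → joins-sym (ends G e) u v)
  ; connected = star
  ; charge≥3 = λ v → charge≥3-criterion 2≤g (graphOf G) star genus′ v
      (λ w≡0 → subst (3 ≤_) (degree≡sum G v) (stable v w≡0))
  ; genus = genus′
  }
  where
  star = λ u v → Reach⇒Star G (conn u v)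
  genus′ = trans (sum-charge-graphOf G) (trans (cong (2 *_) gen) (*-distribˡ-+ 2 g (nV G)))

admissible⇒typeOfGenus : ∀ {g} G → 1 ≤ nV G → Admissible g (graphOf G) → TypeOfGenus g G
admissible⇒typeOfGenus {g} G nonempty good =
  ((nonempty , λ u v → Star⇒Reach G (connected good u v)) , stable) ,
  *-cancelˡ-≡ _ _ 2 (trans (sym (sum-charge-graphOf G)) (trans (genus good) (sym (*-distribˡ-+ 2 g (nV G)))))
  where
  stable : ∀ v → w G v ≡ 0 → 3 ≤ degree G v
  stable v w≡0 = subst (3 ≤_) (trans (cong (λ a → 2 * a + _) w≡0) (sym (degree≡sum G v))) (charge≥3 good v)

Iso⇒≅ : ∀ G H → Iso G H → graphOf G ≅ graphOf H
Iso⇒≅ G H (σ , τ , endpoints , weights) = iso σ weights λ u v → begin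
  sum (λ e → joins (ends H e) (σ ⟨$⟩ʳ u) (σ ⟨$⟩ʳ v))             ≡⟨ sum-permute _ τ ⟩
  sum (λ e → joins (ends H (τ ⟨$⟩ʳ e)) (σ ⟨$⟩ʳ u) (σ ⟨$⟩ʳ v))    ≡⟨ sum-cong-≗ (λ e → joins-cong _ _ (endpoints e) _ _) ⟩
  sum (λ e → joins (σ ⟨$⟩ʳ proj₁ (ends G e) , σ ⟨$⟩ʳ proj₂ (ends G e)) (σ ⟨$⟩ʳ u) (σ ⟨$⟩ʳ v))
                                                                 ≡⟨ sum-cong-≗ (λ e → joins-permute σ (ends G e) u v) ⟩
  sum (λ e → joins (ends G e) u v)                               ∎
  where open ≡-Reasoning

-- Edges are matched one at a time: some g j has the same ends as f 0, and removing both keeps the counts equal.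
match-edges : ∀ {k} (f : Fin m → Fin k × Fin k) (g : Fin n → Fin k × Fin k) →
  (∀ u v → sum (λ e → joins (f e) u v) ≡ sum (λ e → joins (g e) u v)) →
  Σ (Permutation m n) λ τ → ∀ e → SameEnds (g (τ ⟨$⟩ʳ e)) (f e)
match-edges {zero} {zero} f g eq = Perm.id , λ ()
match-edges {zero} {suc n} f g eq = contradiction
  (≤-trans (joins-self (g zero)) (term≤sum (λ e → joins (g e) (proj₁ (g zero)) (proj₂ (g zero))) zero))
  (subst (λ s → ¬ 0 < s) (eq _ _) λ ())
match-edges {suc m} {n} f g eq with sum>0⇒∃ (λ e → joins (g e) (proj₁ (f zero)) (proj₂ (f zero)))
  (subst (0 <_) (eq _ _) (≤-trans (joins-self (f zero)) (term≤sum (λ e → joins (f e) (proj₁ (f zero)) (proj₂ (f zero))) zero)))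
match-edges {suc m} {suc n} f g eq | j , pos = Perm.insert zero j (proj₁ rest) , same
  where
  same₀ : SameEnds (g j) (f zero)
  same₀ = joins>0⇒SameEnds (g j) (proj₁ (f zero)) (proj₂ (f zero)) pos
  rest = match-edges (f ∘ suc) (g ∘ punchIn j) λ u v → +-cancelˡ-≡ (joins (f zero) u v) _ _
    (trans (eq u v) (trans (sum-remove (λ e → joins (g e) u v))
      (cong (_+ sum (λ e → joins (g (punchIn j e)) u v)) (joins-cong (g j) (f zero) same₀ u v))))
  same : ∀ e → SameEnds (g (Perm.insert zero j (proj₁ rest) ⟨$⟩ʳ e)) (f e)
  same zero = same₀
  same (suc e) = subst (λ i → SameEnds (g i) (f (suc e))) (sym (Perm.insert-punchIn zero j (proj₁ rest) e)) (proj₂ rest e)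

≅⇒Iso : ∀ G H → graphOf G ≅ graphOf H → Iso G H
≅⇒Iso G H (iso σ weq aeq) = σ , proj₁ matched , proj₂ matched , weq
  where
  open ≡-Reasoning
  image : Fin (nE G) → Fin (nV H) × Fin (nV H)
  image e = σ ⟨$⟩ʳ proj₁ (ends G e) , σ ⟨$⟩ʳ proj₂ (ends G e)
  -- The edges of `G` are first carried along `σ`, so that both families of edges live on the
  -- vertices of `H` and can be compared entry by entry.
  matched = match-edges image (ends H) λ u v → begin
    sum (λ e → joins (image e) u v)   ≡⟨ sum-cong-≗ (λ e → cong₂ (joins (image e)) (inverseʳ σ) (inverseʳ σ)) ⟨
    sum (λ e → joins (image e) (σ ⟨$⟩ʳ (σ ⟨$⟩ˡ u)) (σ ⟨$⟩ʳ (σ ⟨$⟩ˡ v)))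
                                      ≡⟨ sum-cong-≗ (λ e → joins-permute σ (ends G e) _ _) ⟩
    adj (graphOf G) (σ ⟨$⟩ˡ u) (σ ⟨$⟩ˡ v)   ≡⟨ aeq _ _ ⟨
    adj (graphOf H) (σ ⟨$⟩ʳ (σ ⟨$⟩ˡ u)) (σ ⟨$⟩ʳ (σ ⟨$⟩ˡ v)) ≡⟨ cong₂ (adj (graphOf H)) (inverseʳ σ) (inverseʳ σ) ⟩
    sum (λ e → joins (ends H e) u v)  ∎

-- Realising a symmetric matrix with even diagonal as a multigraph.

EvenDiagonal : Graph n → Set
EvenDiagonal G = ∀ i → adj G i i ≡ 2 * ⌊ adj G i i /2⌋

2*⌊2*k/2⌋ : ∀ k → 2 * ⌊ 2 * k /2⌋ ≡ 2 * k
2*⌊2*k/2⌋ k = cong (2 *_) (trans (cong (λ l → ⌊ k + l /2⌋) (+-identityʳ k)) (sym (n≡⌊n+n/2⌋ k)))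

evenDiagonal-graphOf : ∀ G → EvenDiagonal (graphOf G)
evenDiagonal-graphOf G v = trans double (trans (sym (2*⌊2*k/2⌋ loops)) (cong (λ s → 2 * ⌊ s /2⌋) (sym double)))
  where
  loops = sum (λ e → δ (proj₁ (ends G e)) v * δ (proj₂ (ends G e)) v)
  twice : ∀ x y → x * y + y * x ≡ 2 * (x * y)
  twice = solve-∀
  double : adj (graphOf G) v v ≡ 2 * loops
  double = trans (sum-cong-≗ (λ e → twice (δ (proj₁ (ends G e)) v) (δ (proj₂ (ends G e)) v)))
                 (sym (*-distribˡ-sum 2 (λ e → δ (proj₁ (ends G e)) v * δ (proj₂ (ends G e)) v)))

module _ {A : Set} where

  sumBy : (A → ℕ) → List A → ℕ
  sumBy f [] = 0
  sumBy f (x ∷ xs) = f x + sumBy f xs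

  sum-lookup : ∀ f xs → sum (f ∘ List.lookup xs) ≡ sumBy f xs
  sum-lookup f [] = refl
  sum-lookup f (x ∷ xs) = cong (f x +_) (sum-lookup f xs)

  sumBy-++ : ∀ f xs ys → sumBy f (xs ++ ys) ≡ sumBy f xs + sumBy f ys
  sumBy-++ f [] ys = refl
  sumBy-++ f (x ∷ xs) ys = trans (cong (f x +_) (sumBy-++ f xs ys)) (sym (+-assoc (f x) _ _))

  sumBy-replicate : ∀ f k x → sumBy f (List.replicate k x) ≡ k * f x
  sumBy-replicate f zero x = refl
  sumBy-replicate f (suc k) x = cong (f x +_) (sumBy-replicate f k x)

  sumBy-concatMap : ∀ {B : Set} f (h : B → List A) (k : Fin n → B) →
    sumBy f (List.concatMap h (List.tabulate k)) ≡ sum (λ i → sumBy f (h (k i)))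
  sumBy-concatMap {zero} f h k = refl
  sumBy-concatMap {suc n} f h k = trans (sumBy-++ f (h (k zero)) _)
    (cong (sumBy f (h (k zero)) +_) (sumBy-concatMap f h (k ∘ suc)))

-- Each unordered pair is listed in one order only, and the diagonal is halved because a loop counts
-- 2 there.
multiplicity : Graph n → Fin n → Fin n → ℕ
multiplicity G i j =
  if does (i Fin.<? j) then adj G i j else if does (i Fin.≟ j) then ⌊ adj G i j /2⌋ else 0

multiplicity-sum : ∀ (G : Graph n) → (∀ i j → adj G i j ≡ adj G j i) → EvenDiagonal G →
  ∀ u v → multiplicity G u v + multiplicity G v u ≡ adj G u v
multiplicity-sum G symm even u v with Fin.<-cmp u v
... | tri< u<v u≢v u≯v
  rewrite dec-true (u Fin.<? v) u<v | dec-false (v Fin.<? u) u≯v | dec-false (v Fin.≟ u) (u≢v ∘ sym) = +-identityʳ _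
... | tri≈ u≮u refl _
  rewrite dec-false (u Fin.<? u) u≮u | dec-true (u Fin.≟ u) refl =
    sym (trans (even u) (cong (⌊ adj G u u /2⌋ +_) (+-identityʳ _)))
... | tri> u≮v u≢v v<u
  rewrite dec-true (v Fin.<? u) v<u | dec-false (u Fin.<? v) u≮v | dec-false (u Fin.≟ v) u≢v = symm v u

edges : Graph n → List (Fin n × Fin n)
edges {n} G = List.concatMap (λ i → List.concatMap (λ j → List.replicate (multiplicity G i j) (i , j)) (List.allFin n)) (List.allFin n)

realise : Graph n → WGraph
realise {n} G = record { nV = n ; nE = List.length (edges G) ; ends = List.lookup (edges G) ; w = weight G }

-- A cell `(i , j)` contributes `μ i j` copies of `joins (i , j)`. Its deltas collapse the double
-- sum over cells to `μ u v + μ v u`, which is the entry by `multiplicity-sum`.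
graphOf-realise : ∀ (G : Graph n) → (∀ i j → adj G i j ≡ adj G j i) → EvenDiagonal G → G ≅ graphOf (realise G)
graphOf-realise {n} G symm even = ≗⇒≅ (λ _ → refl) λ u v → begin
  sum (λ e → joins (List.lookup (edges G) e) u v)
    ≡⟨ sum-lookup (λ p → joins p u v) (edges G) ⟩
  sumBy (λ p → joins p u v) (edges G)
    ≡⟨ trans (sumBy-concatMap (λ p → joins p u v) row (λ i → i)) (sum-cong-≗ (λ i →
       trans (sumBy-concatMap (λ p → joins p u v) (cell i) (λ j → j)) (sum-cong-≗ (λ j →
         sumBy-replicate (λ p → joins p u v) (μ i j) (i , j))))) ⟩
  sum (λ i → sum (λ j → μ i j * (δ i u * δ j v + δ j u * δ i v)))
    ≡⟨ sum-cong-≗ (λ i → trans (sum-cong-≗ (λ j → trans (cong₂ (λ x y → μ i j * (δ i u * x + y * δ i v)) (δ-sym j v) (δ-sym j u))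
                                                        (expand (μ i j) (δ i u) (δ v j) (δ u j) (δ i v))))
                        (trans (∑-distrib-+ (λ j → δ v j * (δ i u * μ i j)) (λ j → δ u j * (δ i v * μ i j)))
                               (cong₂ _+_ (sum-δ v (λ j → δ i u * μ i j)) (sum-δ u (λ j → δ i v * μ i j))))) ⟩
  sum (λ i → δ i u * μ i v + δ i v * μ i u)
    ≡⟨ sum-cong-≗ (λ i → cong₂ (λ x y → x * μ i v + y * μ i u) (δ-sym i u) (δ-sym i v)) ⟩
  sum (λ i → δ u i * μ i v + δ v i * μ i u)
    ≡⟨ trans (∑-distrib-+ (λ i → δ u i * μ i v) (λ i → δ v i * μ i u))
             (cong₂ _+_ (sum-δ u (λ i → μ i v)) (sum-δ v (λ i → μ i u))) ⟩
  μ u v + μ v u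
    ≡⟨ multiplicity-sum G symm even u v ⟩
  adj G u v ∎
  where
  open ≡-Reasoning
  μ = multiplicity G
  cell = λ i j → List.replicate (μ i j) (i , j)
  row = λ i → List.concatMap (cell i) (List.allFin n)
  expand : ∀ m a b c d → m * (a * b + c * d) ≡ b * (a * m) + c * (d * m)
  expand = solve-∀

-- Tables and their relabelling

record Table (n : ℕ) : Set where
  constructor table
  field
    weights : Vec ℕ n
    rows    : Vec (Vec ℕ n) n

open Table

⟦_⟧ : Table n → Graph n
⟦ T ⟧ = graph (lookup (weights T)) (λ i j → lookup (lookup (rows T) i) j)

-- Boolean tests built on `_≡ᵇ_` keep equality proofs out of the evaluated enumeration.
_≡ᵛ_ : Vec ℕ n → Vec ℕ n → Bool
[] ≡ᵛ [] = true
(x ∷ xs) ≡ᵛ (y ∷ ys) = (x ≡ᵇ y) ∧ (xs ≡ᵛ ys)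

_≡ᵐ_ : Vec (Vec ℕ n) m → Vec (Vec ℕ n) m → Bool
[] ≡ᵐ [] = true
(r ∷ rs) ≡ᵐ (s ∷ ss) = (r ≡ᵛ s) ∧ (rs ≡ᵐ ss)

_≡ᵗ_ : Table n → Table n → Bool
S ≡ᵗ T = (weights S ≡ᵛ weights T) ∧ (rows S ≡ᵐ rows T)

≡ᵛ⇒≡ : ∀ (xs ys : Vec ℕ n) → Bool.T (xs ≡ᵛ ys) → xs ≡ ys
≡ᵛ⇒≡ [] [] _ = refl
≡ᵛ⇒≡ (x ∷ xs) (y ∷ ys) t with Equivalence.to Bool.T-∧ t
... | x≡y , xs≡ys = cong₂ _∷_ (≡ᵇ⇒≡ x y x≡y) (≡ᵛ⇒≡ xs ys xs≡ys)

≡ᵐ⇒≡ : ∀ (rs ss : Vec (Vec ℕ n) m) → Bool.T (rs ≡ᵐ ss) → rs ≡ ss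
≡ᵐ⇒≡ [] [] _ = refl
≡ᵐ⇒≡ (r ∷ rs) (s ∷ ss) t with Equivalence.to Bool.T-∧ t
... | r≡s , rs≡ss = cong₂ _∷_ (≡ᵛ⇒≡ r s r≡s) (≡ᵐ⇒≡ rs ss rs≡ss)

≡ᵗ⇒≡ : ∀ (S T : Table n) → Bool.T (S ≡ᵗ T) → S ≡ T
≡ᵗ⇒≡ S T t with Equivalence.to Bool.T-∧ t
... | ws≡ , rs≡ = cong₂ table (≡ᵛ⇒≡ _ _ ws≡) (≡ᵐ⇒≡ _ _ rs≡)

-- The isomorphism invariant: colour refinement with a distinguished vertex.

dot : Vec ℕ n → Vec ℕ n → ℕ
dot [] [] = 0
dot (zero ∷ xs) (_ ∷ ys) = dot xs ys
dot (suc x ∷ xs) (y ∷ ys) = suc x * y + dot xs ys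

square : ℕ → ℕ
square x = x * x

-- The constants 3, 2, 5 and 1000 below were found by experiment: they make the keys of the types that occur distinct.
refineWith : Vec (Vec ℕ n) n → Vec ℕ n → Vec ℕ n → Vec ℕ n
refineWith rs xs ys = Vec.zipWith (λ r x → 3 * x + dot r ys) rs xs

-- One round of colour refinement. Squaring makes the sum over neighbours depend on more than the
-- total of their colours; the squares are passed to `refineWith` as an argument, so that all rows
-- share them.
refine : Vec (Vec ℕ n) n → Vec ℕ n → Vec ℕ n
refine rs xs = refineWith rs xs (Vec.map square xs)

unrooted : Table n → Vec ℕ n
unrooted (table ws rs) = refine rs (Vec.map (λ a → square (2 + a)) ws)

mark : Vec (Vec ℕ n) n → Fin n → Vec ℕ n → Vec ℕ n
mark rs r xs = updateAt (Vec.zipWith (λ x a → x + 5 * a) xs (lookup rs r)) r (1000 +_)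

Scored : Set → Set
Scored A = ℕ × A

rooted : Fin n → Vec ℕ n → Scored (Fin n × Vec ℕ n)
rooted r cs = Vec.sum (Vec.map square cs) , r , cs

-- The unrooted colouring is passed as an argument, so that all choices of the root share it.
rootings : Table n → Vec (Scored (Fin n × Vec ℕ n)) n
rootings T = rootingsFrom (unrooted T)
  where
  rootingsFrom : Vec ℕ _ → Vec (Scored (Fin _ × Vec ℕ _)) _
  rootingsFrom xs = tabulate λ r → rooted r (refine (rows T) (refine (rows T) (mark (rows T) r xs)))

-- The first summand sorts the keys by the number of vertices.
keyOf : Vec (Scored (Fin n × Vec ℕ n)) n → ℕ
keyOf {n} es = 16 ^ 100 * n + Vec.sum (Vec.map (square ∘ proj₁) es)

key : Table n → ℕ
key T = keyOf (rootings T)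

-- The score that `rootings` stores at `r`, written as a function of table and root alone for the
-- proof of invariance.
rootHash : Table n → Fin n → ℕ
rootHash T r = Vec.sum (Vec.map square (refine (rows T) (refine (rows T) (mark (rows T) r (unrooted T)))))

lookup-rootings : ∀ (T : Table n) r → lookup (Vec.map (square ∘ proj₁) (rootings T)) r ≡ square (rootHash T r)
lookup-rootings T r = trans (Vec.lookup-map r _ (rootings T))
  (cong (square ∘ proj₁) (Vec.lookup∘tabulate (λ r → rooted r (refine (rows T) (refine (rows T) (mark (rows T) r (unrooted T))))) r))

record Carries (π : Permutation m n) (xs : Vec ℕ m) (ys : Vec ℕ n) : Set where
  constructor carries
  field carried : ∀ i → lookup ys (π ⟨$⟩ʳ i) ≡ lookup xs i

open Carries

map-carries : ∀ {π : Permutation m n} f {xs ys} → Carries π xs ys → Carries π (Vec.map f xs) (Vec.map f ys)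
map-carries f {xs} {ys} c = carries λ i →
  trans (Vec.lookup-map _ f ys) (trans (cong f (carried c i)) (sym (Vec.lookup-map i f xs)))

Vec-sum≡sum : ∀ (xs : Vec ℕ n) → Vec.sum xs ≡ sum (lookup xs)
Vec-sum≡sum [] = refl
Vec-sum≡sum (x ∷ xs) = cong (x +_) (Vec-sum≡sum xs)

dot≡sum : ∀ (xs ys : Vec ℕ n) → dot xs ys ≡ sum (λ i → lookup xs i * lookup ys i)
dot≡sum [] [] = refl
dot≡sum (zero ∷ xs) (_ ∷ ys) = dot≡sum xs ys
dot≡sum (suc x ∷ xs) (y ∷ ys) = cong (suc x * y +_) (dot≡sum xs ys)

Vec-sum-carries : ∀ {π : Permutation m n} {xs ys} → Carries π xs ys → Vec.sum ys ≡ Vec.sum xs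
Vec-sum-carries {π = π} {xs} {ys} c = trans (Vec-sum≡sum ys)
  (trans (sum-permute (lookup ys) π) (trans (sum-cong-≗ (carried c)) (sym (Vec-sum≡sum xs))))

module _ {S : Table m} {T : Table n} (S≅T : ⟦ S ⟧ ≅ ⟦ T ⟧) where

  private π = perm S≅T

  refine-carries : ∀ {xs ys} → Carries π xs ys → Carries π (refine (rows S) xs) (refine (rows T) ys)
  refine-carries {xs} {ys} c = carries λ i → begin
    lookup (refine (rows T) ys) (π ⟨$⟩ʳ i)
      ≡⟨ Vec.lookup-zipWith _ (π ⟨$⟩ʳ i) (rows T) ys ⟩
    3 * lookup ys (π ⟨$⟩ʳ i) + dot (lookup (rows T) (π ⟨$⟩ʳ i)) (Vec.map square ys)
      ≡⟨ cong₂ (λ x s → 3 * x + s) (carried c i) (trans (dot≡sum (lookup (rows T) (π ⟨$⟩ʳ i)) (Vec.map square ys))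
           (trans (sum-permute _ π) (trans (sum-cong-≗ (λ j → cong₂ _*_ (adj≡ S≅T i j) (carried (map-carries square c) j)))
             (sym (dot≡sum (lookup (rows S) i) (Vec.map square xs)))))) ⟩
    3 * lookup xs i + dot (lookup (rows S) i) (Vec.map square xs)
      ≡⟨ Vec.lookup-zipWith _ i (rows S) xs ⟨
    lookup (refine (rows S) xs) i ∎
    where open ≡-Reasoning

  mark-carries : ∀ r {xs ys} → Carries π xs ys → Carries π (mark (rows S) r xs) (mark (rows T) (π ⟨$⟩ʳ r) ys)
  mark-carries r {xs} {ys} c = carries λ i → marked i (i Fin.≟ r)
    where
    shade : ∀ {k} → Vec (Vec ℕ k) k → Fin k → Vec ℕ k → Vec ℕ k
    shade rs r xs = Vec.zipWith (λ x a → x + 5 * a) xs (lookup rs r)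
    shaded : ∀ i → lookup (shade (rows T) (π ⟨$⟩ʳ r) ys) (π ⟨$⟩ʳ i) ≡ lookup (shade (rows S) r xs) i
    shaded i = trans (Vec.lookup-zipWith _ (π ⟨$⟩ʳ i) ys (lookup (rows T) (π ⟨$⟩ʳ r)))
      (trans (cong₂ (λ x a → x + 5 * a) (carried c i) (adj≡ S≅T r i)) (sym (Vec.lookup-zipWith _ i xs (lookup (rows S) r))))
    marked : ∀ i → Dec (i ≡ r) → lookup (mark (rows T) (π ⟨$⟩ʳ r) ys) (π ⟨$⟩ʳ i) ≡ lookup (mark (rows S) r xs) i
    marked i (yes refl) = trans (Vec.lookup∘updateAt _ (shade (rows T) (π ⟨$⟩ʳ i) ys))
      (trans (cong (1000 +_) (shaded i)) (sym (Vec.lookup∘updateAt i (shade (rows S) i xs))))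
    marked i (no i≢r) = trans (Vec.lookup∘updateAt′ _ _ (i≢r ∘ permute-injective π) (shade (rows T) (π ⟨$⟩ʳ r) ys))
      (trans (shaded i) (sym (Vec.lookup∘updateAt′ i r i≢r (shade (rows S) r xs))))

  rootHash-invariant : ∀ r → rootHash T (π ⟨$⟩ʳ r) ≡ rootHash S r
  rootHash-invariant r = Vec-sum-carries {π = π} (map-carries square (refine-carries (refine-carries (mark-carries r
    (refine-carries (map-carries (λ a → square (2 + a)) (carries (weight≡ S≅T))))))))

  -- Mapping, refining and marking all commute with relabelling, so an isomorphism only permutes the
  -- scores of the roots, and their symmetric sum is unchanged.
  key-invariant : key T ≡ key S
  key-invariant = cong₂ (λ k s → 16 ^ 100 * k + s) (sym (Perm.↔⇒≡ π))
    (Vec-sum-carries {π = π} {Vec.map (square ∘ proj₁) (rootings S)} {Vec.map (square ∘ proj₁) (rootings T)}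
      (carries λ r → trans (lookup-rootings T (π ⟨$⟩ʳ r)) (trans (cong square (rootHash-invariant r)) (sym (lookup-rootings S r)))))

-- Choosing a labelling, and relabelling.

pickMax : ∀ {A n} → Scored A → Vec (Scored A) n → Scored A × Vec (Scored A) n
pickMax e [] = e , []
pickMax e (f ∷ fs) = keepBetter e (pickMax f fs)
  where
  keepBetter : ∀ {A n} → Scored A → Scored A × Vec (Scored A) n → Scored A × Vec (Scored A) (suc n)
  keepBetter e (f , fs) = if proj₁ e <ᵇ proj₁ f then (f , e ∷ fs) else (e , f ∷ fs)

huge : ℕ
huge = 1000000000000000000000000000

-- Multiples of huge exceed all colours, so adjacency to the vertices chosen first dominates the choice
-- of the next one, and every vertex after the first is adjacent to an earlier one.
order : Vec (Vec ℕ n) n → Vec (Scored (Fin n)) m → Vec (Fin n) m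
order rs [] = []
order {n} rs (e ∷ es) = continue (pickMax e es)
  where
  reward : ∀ {k} → ℕ → Vec ℕ n → Vec (Scored (Fin n)) k → Vec (Scored (Fin n)) k
  reward bonus r = Vec.map (λ (s , v) → s + bonus * lookup r v , v)
  continue : ∀ {k} → Scored (Fin n) × Vec (Scored (Fin n)) k → Vec (Fin n) (suc k)
  continue {k} ((_ , v) , es) = v ∷ order rs (reward (huge * 8 ^ k) (lookup rs v) es)

-- The root `r` has the greatest score. The second vertex has the largest adjacency entry in the row
-- of the root, ties being decided by the colouring rooted at `r`. Refining with both distinguished
-- should leave few ties.
labelling : Table n → Vec (Scored (Fin n × Vec ℕ n)) n → Vec (Fin n) n
labelling T [] = []
labelling {n} T@(table ws rs) (e ∷ es) = fromRoot (proj₁ (pickMax e es))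
  where
  fromPair : Fin n → Fin n → Vec (Fin n) n
  -- Marking `s` twice tells it apart from `r`, and `huge * huge` makes `r` the first vertex of the
  -- order.
  fromPair r s = order rs (Vec.zip (updateAt (refine rs (refine rs (mark rs s (mark rs s (mark rs r (unrooted T)))))) r (huge * huge +_)) (allFin n))
  fromRoot : Scored (Fin n × Vec ℕ n) → Vec (Fin n) n
  -- The pair `(0 , r)` is the initial candidate that `pickMax` requires; any positive score beats
  -- it.
  fromRoot (_ , r , cs) = fromPair r (proj₂ (proj₁ (pickMax (0 , r)
    (Vec.zipWith (λ a (c , v) → c + huge * a , v) (lookup rs r) (Vec.zip cs (allFin n))))))

permuteBy : ∀ {A : Set} → Vec (Fin n) n → Vec A n → Vec A n
permuteBy p xs = Vec.map (lookup xs) p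

relabel : Vec (Fin n) n → Table n → Table n
relabel p (table ws rs) = table (permuteBy p ws) (Vec.map (permuteBy p) (permuteBy p rs))

-- The starting vector `p` is a placeholder: if `p` is a permutation, every entry gets overwritten.
-- That the result is an inverse is tested afterwards.
inverseOf : Vec (Fin n) n → Vec (Fin n) n
inverseOf p = Vec.foldr′ (λ (v , i) q → updateAt q v (λ _ → i)) p (Vec.zip p (allFin _))

mutuallyInverse? : ∀ (p q : Vec (Fin n) n) → Dec (permuteBy p q ≡ allFin n × permuteBy q p ≡ allFin n)
mutuallyInverse? p q = Vec.≡-dec Fin._≟_ (permuteBy p q) (allFin _) ×-dec Vec.≡-dec Fin._≟_ (permuteBy q p) (allFin _)

-- A successful test supplies the inverse needed for an isomorphism. After a failed one the table
-- stays as it is, so the result is isomorphic to `T` in either case.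
canonical : Table n → Vec (Scored (Fin n × Vec ℕ n)) n → Table n
canonical T es = relabelBy (labelling T es)
  where
  relabelBy : Vec (Fin _) _ → Table _
  relabelBy p = if does (mutuallyInverse? p (inverseOf p)) then relabel p T else T

relabel-≅ : ∀ (p q : Vec (Fin n) n) → permuteBy p q ≡ allFin n → permuteBy q p ≡ allFin n →
            ∀ T → ⟦ relabel p T ⟧ ≅ ⟦ T ⟧
relabel-≅ p q pq qp T = iso (Perm.permutation (lookup p) (lookup q) (inverses q p qp) (inverses p q pq))
  (λ i → sym (Vec.lookup-map i _ p))
  (λ i j → sym (trans (cong (λ r → lookup r j) (trans (Vec.lookup-map i _ (permuteBy p (rows T)))
                                                      (cong (permuteBy p) (Vec.lookup-map i _ p))))
                      (Vec.lookup-map j _ p)))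
  where
  inverses : ∀ (p q : Vec (Fin _) _) → permuteBy p q ≡ allFin _ → ∀ i → lookup q (lookup p i) ≡ i
  inverses p q pq i = trans (sym (Vec.lookup-map i (lookup q) p)) (trans (cong (λ v → lookup v i) pq) (Vec.lookup-allFin i))

if-elim : ∀ {P A : Set} (Q : A → Set) (d : Dec P) {x y} → (P → Q x) → Q y → Q (if does d then x else y)
if-elim Q (yes p) qx qy = qx p
if-elim Q (no _)  qx qy = qy

canonical-≅ : ∀ (T : Table n) es → ⟦ canonical T es ⟧ ≅ ⟦ T ⟧
canonical-≅ T es = if-elim (λ S → ⟦ S ⟧ ≅ ⟦ T ⟧) (mutuallyInverse? (labelling T es) (inverseOf (labelling T es)))
  (λ (pq , qp) → relabel-≅ _ _ pq qp T) (≗⇒≅ (λ _ → refl) (λ _ _ → refl))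

-- Removing duplicates with a search tree.

data Tree (n : ℕ) : Set where
  leaf : Tree n
  node : Tree n → ℕ → Table n → Tree n → Tree n

-- A table is dropped only if an equal table is present. Different tables with the same key are both
-- kept, so no type is lost should the key fail to separate two types.
insert : ℕ → Table n → Tree n → Tree n
insert k T leaf = node leaf k T leaf
insert k T (node l j S r) =
  if k <ᵇ j then force′ (insert k T l) (λ l → node l j S r) else
  if j <ᵇ k then force′ (insert k T r) (node l j S) else
  if S ≡ᵗ T then node l j S r else force′ (insert k T r) (node l j S)

flatten : Tree n → List (Table n) → List (Table n)
flatten leaf Ts = Ts
flatten (node l _ T r) Ts = flatten l (T ∷ flatten r Ts)

entrySum : Table n → ℕ
entrySum (table ws rs) = Vec.sum ws + Vec.sum (Vec.map Vec.sum rs)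

-- Forcing entrySum evaluates the whole table; otherwise every node would keep the colourings of its table alive.
insertCanonical : Table n → Tree n → Tree n
insertCanonical T t = insertRooted (rootings T)
  where
  insertForced : ℕ → Table _ → Tree _
  insertForced k S = force′ (entrySum S) (λ _ → insert k S t)
  insertRooted : Vec (Scored (Fin _ × Vec ℕ _)) _ → Tree _
  insertRooted es = insertForced (keyOf es) (canonical T es)

insertCanonical≡insert : ∀ (T : Table n) t →
  insertCanonical T t ≡ insert (keyOf (rootings T)) (canonical T (rootings T)) t
insertCanonical≡insert T t = force′-≡ (entrySum (canonical T (rootings T))) _

insertAll : Tree n → List (Table n) → Tree n
insertAll t [] = t
insertAll t (T ∷ Ts) = force′ (insertCanonical T t) (λ t′ → insertAll t′ Ts)

-- In increasing order of keys.
dedupe : List (Table n) → List (Table n)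
dedupe Ts = flatten (insertAll leaf Ts) []

data AnyNode (P : Table n → Set) : Tree n → Set where
  root  : ∀ {l k T r} → P T → AnyNode P (node l k T r)
  left  : ∀ {l k T r} → AnyNode P l → AnyNode P (node l k T r)
  right : ∀ {l k T r} → AnyNode P r → AnyNode P (node l k T r)

module _ {P : Table n → Set} where

  forced : ∀ t (f : Tree n → Tree n) → AnyNode P (f t) → AnyNode P (force′ t f)
  forced t f = subst (AnyNode P) (sym (force′-≡ t f))

  insert-new : ∀ k {T} → P T → ∀ t → AnyNode P (insert k T t)
  insert-new k p leaf = root p
  insert-new k {T} p (node l j S r) with k <ᵇ j | j <ᵇ k
  ... | true  | _     = forced (insert k T l) (λ l → node l j S r) (left (insert-new k p l))
  ... | false | true  = forced (insert k T r) (node l j S) (right (insert-new k p r))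
  ... | false | false = if-elim (AnyNode P) (T? (S ≡ᵗ T)) (λ t → root (subst P (sym (≡ᵗ⇒≡ S T t)) p))
                          (forced (insert k T r) (node l j S) (right (insert-new k p r)))

  insert-old : ∀ k T {t} → AnyNode P t → AnyNode P (insert k T t)
  insert-old k T {node l j S r} a with k <ᵇ j | j <ᵇ k
  ... | true | _ = forced (insert k T l) (λ l → node l j S r) (older a)
    where
    older : AnyNode P (node l j S r) → AnyNode P (node (insert k T l) j S r)
    older (root p)  = root p
    older (left a)  = left (insert-old k T a)
    older (right a) = right a
  ... | false | j<k = if-elim′ j<k (forced (insert k T r) (node l j S) (older a))
                        (if-elim (AnyNode P) (T? (S ≡ᵗ T)) (λ _ → a) (forced (insert k T r) (node l j S) (older a)))
    where
    if-elim′ : ∀ b {x y} → AnyNode P x → AnyNode P y → AnyNode P (if b then x else y)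
    if-elim′ true px py = px
    if-elim′ false px py = py
    older : AnyNode P (node l j S r) → AnyNode P (node l j S (insert k T r))
    older (root p)  = root p
    older (left a)  = left a
    older (right a) = right (insert-old k T a)

  flatten-rest : ∀ t {Ts} → Any P Ts → Any P (flatten t Ts)
  flatten-rest leaf a = a
  flatten-rest (node l k T r) a = flatten-rest l (there (flatten-rest r a))

  flatten-tree : ∀ {t} Ts → AnyNode P t → Any P (flatten t Ts)
  flatten-tree Ts (root {l} p) = flatten-rest l (here p)
  flatten-tree Ts (left a) = flatten-tree _ a
  flatten-tree Ts (right {l} a) = flatten-rest l (there (flatten-tree Ts a))

Represents : Graph m → Table n → Set
Represents G T = G ≅ ⟦ T ⟧

dedupe-complete : ∀ {G : Graph m} {Ts : List (Table n)} → Any (Represents G) Ts → Any (Represents G) (dedupe Ts)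
dedupe-complete {n = n} {G} = flatten-tree [] ∘ insertAll-new leaf
  where
  insertAll-old : ∀ {t} (Ts : List (Table n)) → AnyNode (Represents G) t → AnyNode (Represents G) (insertAll t Ts)
  insertAll-old [] a = a
  insertAll-old {t} (T ∷ Ts) a = forced (insertCanonical T t) (λ t′ → insertAll t′ Ts)
    (insertAll-old Ts (subst (AnyNode (Represents G)) (sym (insertCanonical≡insert T t)) (insert-old _ _ a)))
  insertAll-new : ∀ t {Ts : List (Table n)} → Any (Represents G) Ts → AnyNode (Represents G) (insertAll t Ts)
  insertAll-new t {T ∷ Ts} (here G≅T) = forced (insertCanonical T t) (λ t′ → insertAll t′ Ts)
    (insertAll-old Ts (subst (AnyNode (Represents G)) (sym (insertCanonical≡insert T t))
      (insert-new _ (≅-trans G≅T (≅-sym (canonical-≅ T (rootings T)))) t)))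
  insertAll-new t {T ∷ Ts} (there a) = forced (insertCanonical T t) (λ t′ → insertAll t′ Ts) (insertAll-new _ a)

-- Splitting and merging vertices

-- The vectors bounded entrywise by `bs` whose entries add up to at most `t`; once `t` is 0, the
-- zero vector is the only one.
boxes : Vec ℕ n → ℕ → List (Vec ℕ n)
boxes [] t = [] ∷ []
boxes bs@(_ ∷ _) zero = Vec.replicate _ 0 ∷ []
boxes (zero ∷ bs) t@(suc _) = List.map (0 ∷_) (boxes bs t)
boxes (b@(suc _) ∷ bs) t@(suc _) = List.concatMap (λ k → List.map (k ∷_) (boxes bs (t ∸ k))) (List.upTo (suc (b ⊓ t)))

sum≤0⇒zeros : ∀ (ks : Vec ℕ n) → Vec.sum ks ≤ 0 → ks ≡ Vec.replicate n 0
sum≤0⇒zeros [] _ = refl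
sum≤0⇒zeros (zero ∷ ks) sum≤0 = cong (0 ∷_) (sum≤0⇒zeros ks sum≤0)

∈-boxes : ∀ (bs ks : Vec ℕ n) t → (∀ i → lookup ks i ≤ lookup bs i) → Vec.sum ks ≤ t → ks ∈ boxes bs t
∈-boxes [] [] t _ _ = here refl
∈-boxes (_ ∷ _) ks zero _ sum≤0 = here (sum≤0⇒zeros ks sum≤0)
∈-boxes (zero ∷ bs) (k ∷ ks) (suc t) k≤b sum≤t with k | k≤b zero
... | zero | _ = ∈-map⁺ (0 ∷_) (∈-boxes bs ks (suc t) (k≤b ∘ suc) sum≤t)
∈-boxes (b@(suc _) ∷ bs) (k ∷ ks) t@(suc _) k≤b sum≤t = Any.concatMap⁺ (λ k → List.map (k ∷_) (boxes bs (t ∸ k))) (lose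
  (∈-upTo⁺ (s≤s (⊓-glb (k≤b zero) (≤-trans (m≤m+n k (Vec.sum ks)) sum≤t))))
  (∈-map⁺ (k ∷_) (∈-boxes bs ks (t ∸ k) (k≤b ∘ suc)
    (subst (_≤ t ∸ k) (m+n∸m≡n k (Vec.sum ks)) (∸-monoˡ-≤ k sum≤t)))))

-- The new vertex is `zero`, with weight `a` and `ks` edges to the old vertices; those to `x` other
-- than `u` are taken over from `u`. Merging back contracts one edge to `u` and turns the remaining
-- ones into weight, so `u` gives up `a + lookup ks u` less 1; the 1 is added first as `δ x u`. On
-- the diagonal, truncation keeps the entry at 0.
split : Table n → Fin n → ℕ → Vec ℕ n → Table (suc n)
split (table ws rs) u a ks = table
  (a ∷ tabulate λ x → lookup ws x + δ x u ∸ δ x u * (a + lookup ks u))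
  ((0 ∷ ks) ∷ tabulate λ x → lookup ks x ∷ tabulate λ y →
    lookup (lookup rs x) y ∸ (δ x u * lookup ks y + δ y u * lookup ks x))

charges : Table n → Vec ℕ n
charges (table ws rs) = Vec.zipWith (λ a r → 2 * a + Vec.sum r) ws rs

minimum : ℕ → Vec ℕ n → ℕ
minimum = Vec.foldr′ _⊓_

-- The conditions c ≤ t and the last one keep only the splittings where the new vertex has the least charge and
-- the vertex u it is split from has the least charge among its neighbours.
SplitTest : Table n → Vec ℕ n → Fin n → ℕ → Vec ℕ n → ℕ → Set
SplitTest T cs u t ks a =
  3 ≤ c × c ≤ t × a + lookup ks u ≤ suc (lookup (weights T) u) ×
  (∀ x → lookup ks x ≡ 0 ⊎ lookup cs u + 2 ≤ lookup cs x + c)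
  where c = 2 * a + Vec.sum ks

splitTest? : ∀ (T : Table n) cs u t ks a → Dec (SplitTest T cs u t ks a)
splitTest? T cs u t ks a =
  3 ≤? c ×-dec c ≤? t ×-dec a + lookup ks u ≤? suc (lookup (weights T) u) ×-dec
  Fin.all? (λ x → lookup ks x ≟ 0 ⊎-dec lookup cs u + 2 ≤? lookup cs x + c)
  where c = 2 * a + Vec.sum ks

module _ (T : Table n) (cs : Vec ℕ n) (u : Fin n) where

  splitFor : ℕ → Vec ℕ n → ℕ → List (Table (suc n))
  splitFor t ks a = if does (splitTest? T cs u t ks a) then split T u a ks ∷ [] else []

  splitsFor : ℕ → Vec ℕ n → List (Table (suc n))
  splitsFor t ks =
    if does (1 ≤? lookup ks u) then List.concatMap (splitFor t ks) (List.upTo (suc (lookup (weights T) u))) else []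

  -- Edges between the new vertex and `u` are made out of the weight of `u`, except for the one that
  -- merging contracts: hence one more than the weight.
  splitBounds : Vec ℕ n
  splitBounds = updateAt (lookup (rows T) u) u (λ _ → suc (lookup (weights T) u))

  splitsAt : ℕ → List (Table (suc n))
  splitsAt t = if does (3 ≤? t) then List.concatMap (splitsFor t) (boxes splitBounds t) else []

-- The two charges arising from `u` add up to the old one plus 2, and the new vertex takes the
-- smaller: hence the halving. The other charges do not change and bound it as well.
leastCharge : Vec ℕ n → Fin n → ℕ
leastCharge cs u = minimum ⌊ 2 + lookup cs u /2⌋ cs

splits : Table n → List (Table (suc n))
splits {n} T = splitsOf (charges T)
  where
  splitsOf : Vec ℕ n → List (Table (suc n))
  splitsOf cs = List.concatMap (λ u → splitsAt T cs u (leastCharge cs u)) (List.allFin n)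

lookup-charges : ∀ (T : Table n) i → lookup (charges T) i ≡ charge ⟦ T ⟧ i
lookup-charges (table ws rs) i = trans (Vec.lookup-zipWith _ i ws rs) (cong (2 * lookup ws i +_) (Vec-sum≡sum (lookup rs i)))

≤-minimum : ∀ {s t} (xs : Vec ℕ n) → s ≤ t → (∀ i → s ≤ lookup xs i) → s ≤ minimum t xs
≤-minimum [] s≤t _ = s≤t
≤-minimum (x ∷ xs) s≤t s≤xs = ⊓-glb (s≤xs zero) (≤-minimum xs s≤t (s≤xs ∘ suc))

∈-if : ∀ {P A : Set} {x : A} {xs} (d : Dec P) → P → x ∈ xs → x ∈ (if does d then xs else [])
∈-if {x = x} {xs} d p x∈xs = subst (λ b → x ∈ (if b then xs else [])) (sym (dec-true d p)) x∈xs

∈-splits : ∀ (T : Table n) u a ks →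
  1 ≤ lookup ks u → 3 ≤ 2 * a + Vec.sum ks → a + lookup ks u ≤ suc (lookup (weights T) u) →
  (∀ x → x ≢ u → lookup ks x ≤ adj ⟦ T ⟧ u x) →
  2 * (2 * a + Vec.sum ks) ≤ 2 + charge ⟦ T ⟧ u → (∀ x → 2 * a + Vec.sum ks ≤ charge ⟦ T ⟧ x) →
  (∀ x → 0 < lookup ks x → charge ⟦ T ⟧ u + 2 ≤ charge ⟦ T ⟧ x + (2 * a + Vec.sum ks)) →
  split T u a ks ∈ splits T
∈-splits {n} T u a ks ku≥1 c≥3 fits ks≤row c≤half c≤all nearest =
  Any.concatMap⁺ (λ u → splitsAt T cs u (leastCharge cs u)) (lose (∈-allFin u)
    (∈-if (3 ≤? t) (≤-trans c≥3 c≤t)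
      (Any.concatMap⁺ (splitsFor T cs u t) (lose (∈-boxes (splitBounds T cs u) ks t ks≤bounds (≤-trans (m≤n+m _ (2 * a)) c≤t))
        (∈-if (1 ≤? lookup ks u) ku≥1
          (Any.concatMap⁺ (splitFor T cs u t ks) (lose (∈-upTo⁺ (s≤s a≤w))
            (∈-if (splitTest? T cs u t ks a) (c≥3 , c≤t , fits , near) (here refl)))))))))
  where
  cs = charges T
  t = leastCharge cs u
  c = 2 * a + Vec.sum ks
  c≤t : c ≤ t
  c≤t = ≤-minimum (charges T)
    (subst₂ _≤_ (sym (trans (n≡⌊n+n/2⌋ c) (cong (λ d → ⌊ c + d /2⌋) (sym (+-identityʳ c))))) (cong (λ d → ⌊ 2 + d /2⌋) (sym (lookup-charges T u))) (⌊n/2⌋-mono c≤half))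
    (λ i → subst (c ≤_) (sym (lookup-charges T i)) (c≤all i))
  a≤w : a ≤ lookup (weights T) u
  a≤w = s≤s⁻¹ (≤-trans (≤-trans (≤-reflexive (+-comm 1 a)) (+-monoʳ-≤ a ku≥1)) fits)
  ks≤bounds : ∀ x → lookup ks x ≤ lookup (splitBounds T cs u) x
  ks≤bounds x with x Fin.≟ u
  ... | yes refl = subst (lookup ks x ≤_) (sym (Vec.lookup∘updateAt x (lookup (rows T) x))) (≤-trans (m≤n+m _ a) fits)
  ... | no x≢u = subst (lookup ks x ≤_) (sym (Vec.lookup∘updateAt′ x u x≢u (lookup (rows T) u))) (ks≤row x x≢u)
  near : ∀ x → lookup ks x ≡ 0 ⊎ lookup cs u + 2 ≤ lookup cs x + c
  near x with lookup ks x | nearest x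
  ... | zero  | _ = inj₁ refl
  ... | suc _ | le = inj₂ (subst₂ (λ d e → d + 2 ≤ e + c) (sym (lookup-charges T u)) (sym (lookup-charges T x)) (le z<s))

-- Merging two adjacent vertices, and recovering the graph by a splitting.

merged-adj : Graph (suc n) → Fin n → Fin n → Fin n → ℕ
merged-adj G u x y = adj G (suc x) (suc y) + (δ x u * adj G zero (suc y) + δ y u * adj G zero (suc x))

-- Edges of G joining the two merged vertices become loops; one of them is contracted and the others
-- are absorbed into the weight.
merge : Graph (suc n) → Fin n → Graph n
merge G u = graph
  (λ x → weight G (suc x) + δ x u * (weight G zero + (adj G zero (suc u) ∸ 1)))
  (λ x y → (1 ∸ δ x y) * merged-adj G u x y)

-- With this, `merge G u` can be given the labelling of a listed table by relabelling `G` itself,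
-- `zero` staying fixed.
merge-reindex : ∀ (π : Permutation n n) (G : Graph (suc n)) u →
  reindex π (merge G (π ⟨$⟩ʳ u)) ≅ merge (reindex (Perm.lift₀ π) G) u
merge-reindex π G u = ≗⇒≅
  (λ x → cong (λ d → weight G (suc (π ⟨$⟩ʳ x)) + d * (weight G zero + (adj G zero (suc (π ⟨$⟩ʳ u)) ∸ 1)))
              (sym (δ-permute π x u)))
  (λ x y → cong₂ (λ d s → (1 ∸ d) * (adj G (suc (π ⟨$⟩ʳ x)) (suc (π ⟨$⟩ʳ y)) + s)) (sym (δ-permute π x y))
    (cong₂ (λ d e → d * adj G zero (suc (π ⟨$⟩ʳ y)) + e * adj G zero (suc (π ⟨$⟩ʳ x)))
           (sym (δ-permute π x u)) (sym (δ-permute π y u))))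

module _ {g} (G : Graph (suc n)) (good : Admissible g G) (loopless : Loopless G)
         (u : Fin n) (0~u : Adjacent G zero (suc u)) where

  private
    M = merge G u
    p = adj G zero (suc u) ∸ 1

    k≡1+p : adj G zero (suc u) ≡ suc p
    k≡1+p = sym (m+[n∸m]≡n 0~u)

  merge-loopless : Loopless M
  merge-loopless x = cong (λ d → (1 ∸ d) * merged-adj G u x x) (δ-same x)

  adj-merge : ∀ {x y} → x ≢ y → adj M x y ≡ merged-adj G u x y
  adj-merge {x} {y} x≢y = trans (cong (λ d → (1 ∸ d) * merged-adj G u x y) (δ-distinct x≢y)) (*-identityˡ _)

  adj-merge-away : ∀ {x y} → x ≢ u → y ≢ u → adj M x y ≡ adj G (suc x) (suc y)
  adj-merge-away {x} {y} x≢u y≢u with x Fin.≟ y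
  ... | yes refl = sym (loopless (suc x))
  ... | no x≢y = trans (*-identityˡ _) (trans (cong (adj G (suc x) (suc y) +_)
    (cong₂ (λ d e → d * adj G zero (suc y) + e * adj G zero (suc x)) (δ-distinct x≢u) (δ-distinct y≢u))) (+-identityʳ _))

  adj-merge-u : ∀ {x} → x ≢ u → adj M x u ≡ adj G (suc x) (suc u) + adj G zero (suc x)
  adj-merge-u {x} x≢u = trans (adj-merge x≢u) (cong (adj G (suc x) (suc u) +_)
    (trans (cong₂ (λ d e → d * adj G zero (suc u) + e * adj G zero (suc x)) (δ-distinct x≢u) (δ-same u)) (*-identityˡ _)))

  merge-symmetric : ∀ x y → adj M x y ≡ adj M y x
  merge-symmetric x y = cong₂ (λ d s → (1 ∸ d) * s) (δ-sym x y)
    (cong₂ _+_ (symmetric good (suc x) (suc y)) (+-comm (δ x u * adj G zero (suc y)) (δ y u * adj G zero (suc x))))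

  charge-merge-away : ∀ {x} → x ≢ u → charge M x ≡ charge G (suc x)
  charge-merge-away {x} x≢u = cong₂ (λ a s → 2 * a + s)
    (trans (cong (λ d → weight G (suc x) + d * (weight G zero + p)) (δ-distinct x≢u)) (+-identityʳ _))
    (+-cancelʳ-≡ (adj G (suc x) (suc u)) _ _ (begin
      sum (adj M x) + adj G (suc x) (suc u)
        ≡⟨ sum-differ-at u (adj M x) (adj G (suc x) ∘ suc) (λ y y≢u → adj-merge-away x≢u y≢u) ⟩
      sum (adj G (suc x) ∘ suc) + adj M x u
        ≡⟨ cong (sum (adj G (suc x) ∘ suc) +_) (trans (adj-merge-u x≢u) (cong (adj G (suc x) (suc u) +_) (symmetric good zero (suc x)))) ⟩
      sum (adj G (suc x) ∘ suc) + (adj G (suc x) (suc u) + adj G (suc x) zero)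
        ≡⟨ rotate (sum (adj G (suc x) ∘ suc)) (adj G (suc x) (suc u)) (adj G (suc x) zero) ⟩
      sum (adj G (suc x)) + adj G (suc x) (suc u) ∎))
    where
    open ≡-Reasoning
    rotate : ∀ s a b → s + (a + b) ≡ (b + s) + a
    rotate = solve-∀

  -- The `p + 1` edges between the two vertices leave the degrees, which costs `2(p + 1)`, and `p`
  -- of them become weight, which gives back `2p`: a net loss of 2.
  charge-merge-u : charge M u + 2 ≡ charge G (suc u) + charge G zero
  charge-merge-u = begin
    charge M u + 2
      ≡⟨ cong (λ d → 2 * (weight G (suc u) + d * (weight G zero + p)) + sum (adj M u) + 2) (δ-same u) ⟩
    2 * (weight G (suc u) + 1 * (weight G zero + p)) + sum (adj M u) + 2
      ≡⟨ regroup (weight G (suc u)) (weight G zero) p (sum (adj M u)) ⟩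
    2 * weight G (suc u) + 2 * weight G zero + suc p + (sum (adj M u) + suc p)
      ≡⟨ cong₂ (λ k s → 2 * weight G (suc u) + 2 * weight G zero + k + s) (sym k≡1+p) row ⟩
    2 * weight G (suc u) + 2 * weight G zero + adj G zero (suc u) + (sum (adj G (suc u) ∘ suc) + sum (adj G zero ∘ suc))
      ≡⟨ distribute (weight G (suc u)) (weight G zero) (sum (adj G (suc u) ∘ suc)) (sum (adj G zero ∘ suc)) (adj G zero (suc u)) ⟩
    2 * weight G (suc u) + (adj G zero (suc u) + sum (adj G (suc u) ∘ suc)) + (2 * weight G zero + (0 + sum (adj G zero ∘ suc)))
      ≡⟨ cong₂ (λ a b → 2 * weight G (suc u) + (a + sum (adj G (suc u) ∘ suc)) + (2 * weight G zero + (b + sum (adj G zero ∘ suc))))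
           (symmetric good zero (suc u)) (sym (loopless zero)) ⟩
    charge G (suc u) + charge G zero ∎
    where
    open ≡-Reasoning
    regroup : ∀ a b p s → 2 * (a + 1 * (b + p)) + s + 2 ≡ 2 * a + 2 * b + suc p + (s + suc p)
    regroup = solve-∀
    distribute : ∀ a b s t k → 2 * a + 2 * b + k + (s + t) ≡ 2 * a + (k + s) + (2 * b + (0 + t))
    distribute = solve-∀
    union : Fin n → ℕ
    union y = adj G (suc u) (suc y) + adj G zero (suc y)
    row : sum (adj M u) + suc p ≡ sum (adj G (suc u) ∘ suc) + sum (adj G zero ∘ suc)
    row = begin
      sum (adj M u) + suc p      ≡⟨ cong (sum (adj M u) +_) (trans (sym k≡1+p) (cong (_+ adj G zero (suc u)) (sym (loopless (suc u))))) ⟩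
      sum (adj M u) + union u    ≡⟨ sum-differ-at u (adj M u) union (λ y y≢u → trans (merge-symmetric u y)
                                      (trans (adj-merge-u y≢u) (cong (_+ adj G zero (suc y)) (symmetric good (suc y) (suc u))))) ⟩
      sum union + adj M u u      ≡⟨ cong (sum union +_) (merge-loopless u) ⟩
      sum union + 0              ≡⟨ +-identityʳ (sum union) ⟩
      sum union                  ≡⟨ ∑-distrib-+ (adj G (suc u) ∘ suc) (adj G zero ∘ suc) ⟩
      sum (adj G (suc u) ∘ suc) + sum (adj G zero ∘ suc) ∎

  merge-charge≥3 : ∀ x → 3 ≤ charge M x
  merge-charge≥3 x = by-cases (x Fin.≟ u)
    where
    by-cases : Dec (x ≡ u) → 3 ≤ charge M x
    by-cases (yes refl) = ≤-trans (n≤1+n 3) (+-cancelʳ-≤ 2 4 (charge M x)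
      (subst (6 ≤_) (sym charge-merge-u) (+-mono-≤ (charge≥3 good (suc x)) (charge≥3 good zero))))
    by-cases (no x≢u) = subst (3 ≤_) (sym (charge-merge-away x≢u)) (charge≥3 good (suc x))

  -- The total charge drops by 2, and so does twice the number of vertices.
  merge-genus : sum (charge M) + 2 ≡ 2 * g + 2 * n
  merge-genus = +-cancelʳ-≡ 2 _ _ (begin
    sum (charge M) + 2 + 2        ≡⟨ cong (_+ 2) total ⟩
    charge G zero + rest + 2      ≡⟨ genus good ⟩
    2 * g + 2 * suc n             ≡⟨ next g n ⟩
    2 * g + 2 * n + 2             ∎)
    where
    open ≡-Reasoning
    rest = sum (charge G ∘ suc)
    next : ∀ g n → 2 * g + 2 * suc n ≡ 2 * g + 2 * n + 2
    next = solve-∀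
    swap-last : ∀ s a b → s + a + b ≡ s + b + a
    swap-last = solve-∀
    rotate : ∀ s a b → s + (a + b) ≡ b + s + a
    rotate = solve-∀
    total : sum (charge M) + 2 ≡ charge G zero + rest
    total = +-cancelʳ-≡ (charge G (suc u)) _ _ (begin
      sum (charge M) + 2 + charge G (suc u)    ≡⟨ swap-last (sum (charge M)) 2 (charge G (suc u)) ⟩
      sum (charge M) + charge G (suc u) + 2    ≡⟨ cong (_+ 2) (sum-differ-at u (charge M) (charge G ∘ suc) (λ x → charge-merge-away)) ⟩
      rest + charge M u + 2                    ≡⟨ +-assoc rest (charge M u) 2 ⟩
      rest + (charge M u + 2)                  ≡⟨ cong (rest +_) charge-merge-u ⟩
      rest + (charge G (suc u) + charge G zero) ≡⟨ rotate rest (charge G (suc u)) (charge G zero) ⟩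
      charge G zero + rest + charge G (suc u)  ∎)

  private
    image : Fin (suc n) → Fin n
    image zero = u
    image (suc x) = x

  image-adjacent : ∀ i j → Adjacent G i j → image i ≢ image j → Adjacent M (image i) (image j)
  image-adjacent zero zero _ u≢u = contradiction refl u≢u
  image-adjacent zero (suc y) 0~y u≢y = subst (0 <_) (trans (sym (adj-merge-u (u≢y ∘ sym))) (merge-symmetric y u)) (≤-trans 0~y (m≤n+m _ _))
  image-adjacent (suc x) zero x~0 x≢u = subst (0 <_) (sym (adj-merge-u x≢u)) (≤-trans (subst (0 <_) (symmetric good (suc x) zero) x~0) (m≤n+m _ _))
  image-adjacent (suc x) (suc y) x~y x≢y = subst (0 <_) (sym (adj-merge x≢y)) (≤-trans x~y (m≤m+n _ _))

  merge-admissible : Admissible g M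
  merge-admissible = record
    { symmetric = merge-symmetric
    ; connected = λ x y → Star-collapse image image-adjacent (connected good (suc x) (suc y))
    ; charge≥3 = merge-charge≥3
    ; genus = merge-genus
    }

  module _ (T : Table n) (wT : ∀ x → weight ⟦ T ⟧ x ≡ weight M x) (aT : ∀ x y → adj ⟦ T ⟧ x y ≡ adj M x y) where

    private
      ks = tabulate (adj G zero ∘ suc)
      S = split T u (weight G zero) ks

      lookup-ks : ∀ x → lookup ks x ≡ adj G zero (suc x)
      lookup-ks = Vec.lookup∘tabulate (adj G zero ∘ suc)

      row : Fin n → Vec ℕ (suc n)
      row x = lookup ks x ∷ tabulate λ y → adj ⟦ T ⟧ x y ∸ (δ x u * lookup ks y + δ y u * lookup ks x)

      weight-S : ∀ x → weight ⟦ S ⟧ (suc x) ≡ weight G (suc x)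
      weight-S x = trans (Vec.lookup∘tabulate _ x) (trans (cong₂ (λ a k → a + δ x u ∸ δ x u * (weight G zero + k)) (wT x) (trans (lookup-ks u) k≡1+p)) unmerged)
        where
        unmerged : weight G (suc x) + δ x u * (weight G zero + p) + δ x u ∸ δ x u * (weight G zero + suc p) ≡ weight G (suc x)
        unmerged = trans (cong (_∸ δ x u * (weight G zero + suc p)) (regroup (weight G (suc x)) (δ x u) (weight G zero) p))
                         (m+n∸n≡m (weight G (suc x)) (δ x u * (weight G zero + suc p)))
          where
          regroup : ∀ a d b p → a + d * (b + p) + d ≡ a + d * (b + suc p)
          regroup = solve-∀

      adj-S : ∀ x y → adj ⟦ S ⟧ (suc x) (suc y) ≡ adj G (suc x) (suc y)
      adj-S x y = trans (cong (λ r → lookup r (suc y)) (Vec.lookup∘tabulate row x))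
        (trans (Vec.lookup∘tabulate (λ y → adj ⟦ T ⟧ x y ∸ (δ x u * lookup ks y + δ y u * lookup ks x)) y)
        (trans (cong₂ (λ a b → a ∸ b) (aT x y) (cong₂ (λ k l → δ x u * k + δ y u * l) (lookup-ks y) (lookup-ks x))) unmerged))
        where
        cross = δ x u * adj G zero (suc y) + δ y u * adj G zero (suc x)
        unmerged : adj M x y ∸ cross ≡ adj G (suc x) (suc y)
        unmerged with x Fin.≟ y
        ... | yes refl = trans (0∸n≡0 cross) (sym (loopless (suc x)))
        ... | no x≢y = trans (cong (_∸ cross) (*-identityˡ (merged-adj G u x y))) (m+n∸n≡m (adj G (suc x) (suc y)) cross)

    -- What `split` subtracts is exactly what `merge` added, so truncation does no harm; on the
    -- diagonal both sides are 0 because `G` is loopless.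
    split-recovers : G ≅ ⟦ S ⟧
    split-recovers = ≗⇒≅
      (λ { zero → refl ; (suc x) → weight-S x })
      (λ { zero zero → sym (loopless zero)
         ; zero (suc y) → lookup-ks y
         ; (suc x) zero → trans (cong (λ r → lookup r zero) (Vec.lookup∘tabulate row x)) (trans (lookup-ks x) (symmetric good zero (suc x)))
         ; (suc x) (suc y) → adj-S x y })

    split-listed : (∀ i → charge G zero ≤ charge G i) →
      (∀ x → Adjacent G zero (suc x) → charge G (suc u) ≤ charge G (suc x)) → S ∈ splits T
    split-listed least nearest = ∈-splits T u (weight G zero) ks
      (subst (1 ≤_) (sym (lookup-ks u)) 0~u)
      (subst (3 ≤_) (sym charge-0) (charge≥3 good zero))
      (subst₂ (λ k a → weight G zero + k ≤ suc a) (trans (sym k≡1+p) (sym (lookup-ks u))) (sym (wT u)) fits)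
      (λ x x≢u → subst₂ _≤_ (sym (lookup-ks x)) (sym (trans (aT u x) (trans (merge-symmetric u x) (adj-merge-u x≢u)))) (m≤n+m _ _))
      -- Twice the least charge is at most the sum of the charges of `zero` and `u`, which is the
      -- merged charge plus 2.
      (subst₂ (λ c d → 2 * c ≤ 2 + d) (sym charge-0) (sym (chargeT u))
        (subst₂ _≤_ (cong (charge G zero +_) (sym (+-identityʳ (charge G zero)))) (trans (sym charge-merge-u) (+-comm (charge M u) 2))
          (+-monoˡ-≤ (charge G zero) (least (suc u)))))
      (λ x → subst₂ _≤_ (sym charge-0) (sym (chargeT x)) (least-merged x (x Fin.≟ u)))
      (λ x 0<k → subst₂ _≤_ (cong (_+ 2) (sym (chargeT u))) (cong₂ _+_ (sym (chargeT x)) (sym charge-0))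
        (nearest-merged x (x Fin.≟ u) (subst (0 <_) (lookup-ks x) 0<k)))
      where
      charge-0 : 2 * weight G zero + Vec.sum ks ≡ charge G zero
      charge-0 = cong (2 * weight G zero +_) (trans (Vec-sum≡sum ks) (trans (sum-cong-≗ lookup-ks)
        (cong (_+ sum (adj G zero ∘ suc)) (sym (loopless zero)))))
      chargeT : ∀ x → charge ⟦ T ⟧ x ≡ charge M x
      chargeT = charge≡ {G = M} {H = ⟦ T ⟧} (≗⇒≅ wT aT)
      fits : weight G zero + suc p ≤ suc (weight M u)
      fits = subst₂ _≤_ (sym (+-suc (weight G zero) p))
        (cong (λ d → suc (weight G (suc u) + d)) (sym (trans (cong (_* (weight G zero + p)) (δ-same u)) (*-identityˡ (weight G zero + p)))))
        (s≤s (m≤n+m (weight G zero + p) (weight G (suc u))))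
      least-merged : ∀ x → Dec (x ≡ u) → charge G zero ≤ charge M x
      least-merged x (yes refl) = +-cancelʳ-≤ 2 _ _ (subst (charge G zero + 2 ≤_) (sym charge-merge-u)
        (subst (_≤ charge G (suc x) + charge G zero) (+-comm 2 (charge G zero))
          (+-monoˡ-≤ (charge G zero) (≤-trans (n≤1+n 2) (charge≥3 good (suc x))))))
      least-merged x (no x≢u) = subst (charge G zero ≤_) (sym (charge-merge-away x≢u)) (least (suc x))
      nearest-merged : ∀ x → Dec (x ≡ u) → Adjacent G zero (suc x) → charge M u + 2 ≤ charge M x + charge G zero
      nearest-merged x (yes refl) _ = +-monoʳ-≤ (charge M x) (≤-trans (n≤1+n 2) (charge≥3 good zero))
      nearest-merged x (no x≢u) 0~x = subst₂ _≤_ (sym charge-merge-u) (cong (_+ charge G zero) (sym (charge-merge-away x≢u)))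
        (+-monoˡ-≤ (charge G zero) (nearest x 0~x))

-- Every loopless type arises by splitting.

argmin : ∀ {P : Fin n → Set} → (∀ i → Dec (P i)) → ∀ (f : Fin n → ℕ) → ∃ P →
  ∃ λ v → P v × ∀ i → P i → f v ≤ f i
argmin {P = P} P? f (v , pv) = descend v pv (<-wellFounded (f v))
  where
  descend : ∀ v → P v → Acc _<_ (f v) → ∃ λ v → P v × ∀ i → P i → f v ≤ f i
  descend v pv (acc smaller) with Fin.any? (λ i → P? i ×-dec f i <? f v)
  ... | yes (i , pi , fi<fv) = descend i pi (smaller fi<fv)
  ... | no ∄i = v , pv , λ i pi → ≮⇒≥ (λ fi<fv → ∄i (i , pi , fi<fv))

ListsLoopless : ℕ → List (Table n) → Set
ListsLoopless {n} g Ts = ∀ (G : Graph n) → Admissible g G → Loopless G → Any (Represents G) Ts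

-- The table has to agree with the merged graph entry by entry, whereas `T` is only isomorphic to
-- it. The isomorphism is therefore lifted to a relabelling `H` of `G` that fixes `zero`, and `H` is
-- merged instead.
unmerge : ∀ {g} (G : Graph (suc n)) → Admissible g G → Loopless G → (∀ i → charge G zero ≤ charge G i) →
  ∀ u → Adjacent G zero (suc u) → (∀ x → Adjacent G zero (suc x) → charge G (suc u) ≤ charge G (suc x)) →
  ∀ T → Represents (merge G u) T → Any (Represents G) (splits T)
unmerge {n} G good loopless least u 0~u nearest T M≅T =
  lose (split-listed H good′ loopless′ u′ 0~u′ T wT aT least′ nearest′)
       (≅-trans (≅-sym H≅G) (split-recovers H good′ loopless′ u′ 0~u′ T wT aT))
  where
  T≅M : ⟦ T ⟧ ≅ merge G u
  T≅M = ≅-sym M≅T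
  τ : Permutation n n
  τ = perm T≅M
  H : Graph (suc n)
  H = reindex (Perm.lift₀ τ) G
  H≅G : H ≅ G
  H≅G = reindex-≅ (Perm.lift₀ τ) G
  good′ = admissible-≅ (≅-sym H≅G) good
  loopless′ = loopless-≅ (≅-sym H≅G) loopless
  least′ : ∀ i → charge H zero ≤ charge H i
  least′ i = subst₂ _≤_ (charge≡ H≅G zero) (charge≡ H≅G i) (least _)
  u′ : Fin n
  u′ = τ ⟨$⟩ˡ u
  τu′≡u : τ ⟨$⟩ʳ u′ ≡ u
  τu′≡u = inverseʳ τ
  0~u′ : Adjacent H zero (suc u′)
  0~u′ = subst (λ u → Adjacent G zero (suc u)) (sym τu′≡u) 0~u
  nearest′ : ∀ x → Adjacent H zero (suc x) → charge H (suc u′) ≤ charge H (suc x)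
  nearest′ x 0~x = subst₂ _≤_ (trans (cong (λ u → charge G (suc u)) (sym τu′≡u)) (charge≡ H≅G (suc u′))) (charge≡ H≅G (suc x)) (nearest (τ ⟨$⟩ʳ x) 0~x)
  wT : ∀ x → weight ⟦ T ⟧ x ≡ weight (merge H u′) x
  wT x = trans (sym (weight≡ T≅M x)) (trans (cong (λ u → weight (merge G u) (τ ⟨$⟩ʳ x)) (sym τu′≡u))
    (sym (weight≡ (merge-reindex τ G u′) x)))
  aT : ∀ x y → adj ⟦ T ⟧ x y ≡ adj (merge H u′) x y
  aT x y = trans (sym (adj≡ T≅M x y)) (trans (cong (λ u → adj (merge G u) (τ ⟨$⟩ʳ x) (τ ⟨$⟩ʳ y)) (sym τu′≡u))
    (sym (adj≡ (merge-reindex τ G u′) x y)))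

module _ {g} {Ts : List (Table (suc n))} (complete : ListsLoopless g Ts) where

  splits-complete-least : ∀ G → Admissible g G → Loopless G → (∀ i → charge G zero ≤ charge G i) →
    Any (Represents G) (List.concatMap splits Ts)
  splits-complete-least G good loopless least = from-nearest (argmin (λ x → 0 <? adj G zero (suc x)) (charge G ∘ suc) other)
    where
    other : ∃ λ x → Adjacent G zero (suc x)
    other with neighbour G (connected good) zero
    ... | zero , 0~0 = contradiction (subst (0 <_) (loopless zero) 0~0) λ ()
    ... | suc x , 0~x = x , 0~x
    from-nearest : (∃ λ u → Adjacent G zero (suc u) × ∀ x → Adjacent G zero (suc x) → charge G (suc u) ≤ charge G (suc x)) →
      Any (Represents G) (List.concatMap splits Ts)
    from-nearest (u , 0~u , nearest) = Any.concatMap⁺ splits (Any.map (λ {T} → unmerge G good loopless least u 0~u nearest T)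
      (complete (merge G u) (merge-admissible G good loopless u 0~u) (merge-loopless G good loopless u 0~u)))

  splits-complete : ListsLoopless g (dedupe (List.concatMap splits Ts))
  splits-complete G good loopless = dedupe-complete (Any.map (≅-trans (≅-sym H≅G))
    (splits-complete-least H (admissible-≅ (≅-sym H≅G) good) (loopless-≅ (≅-sym H≅G) loopless) least′))
    where
    minimiser = argmin {P = λ _ → ⊤} (λ _ → yes _) (charge G) (zero , _)
    v = proj₁ minimiser
    π : Permutation (suc (suc n)) (suc (suc n))
    -- The transposition brings a vertex of least charge to `zero`, the position of the vertex to be
    -- merged.
    π = Perm.transpose zero v
    H : Graph (suc (suc n))
    H = reindex π G
    H≅G : H ≅ G
    H≅G = reindex-≅ π G
    least′ : ∀ i → charge H zero ≤ charge H i
    least′ i = subst₂ _≤_ (charge≡ H≅G zero) (charge≡ H≅G i) (proj₂ (proj₂ minimiser) (π ⟨$⟩ʳ i) _)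

-- Loops

contractLoops : Graph n → Graph n
contractLoops G = graph (λ i → weight G i + ⌊ adj G i i /2⌋) (λ i j → (1 ∸ δ i j) * adj G i j)

module _ {g} (G : Graph n) (good : Admissible g G) (even : EvenDiagonal G) where

  private C = contractLoops G

  contractLoops-loopless : Loopless C
  contractLoops-loopless i = cong (λ d → (1 ∸ d) * adj G i i) (δ-same i)

  adj-contractLoops : ∀ {i j} → i ≢ j → adj C i j ≡ adj G i j
  adj-contractLoops {i} {j} i≢j = trans (cong (λ d → (1 ∸ d) * adj G i j) (δ-distinct i≢j)) (*-identityˡ (adj G i j))

  -- A loop counts 2 in the degree, and the unit of weight replacing it counts 2 in the charge.
  charge-contractLoops : ∀ i → charge C i ≡ charge G i
  charge-contractLoops i = begin
    2 * (weight G i + ⌊ adj G i i /2⌋) + sum (adj C i)     ≡⟨ regroup (weight G i) ⌊ adj G i i /2⌋ (sum (adj C i)) ⟩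
    2 * weight G i + (sum (adj C i) + 2 * ⌊ adj G i i /2⌋) ≡⟨ cong (λ s → 2 * weight G i + (sum (adj C i) + s)) (even i) ⟨
    2 * weight G i + (sum (adj C i) + adj G i i)           ≡⟨ cong (2 * weight G i +_) (sum-differ-at i (adj C i) (adj G i) (λ j j≢i → adj-contractLoops (j≢i ∘ sym))) ⟩
    2 * weight G i + (sum (adj G i) + adj C i i)           ≡⟨ cong (λ s → 2 * weight G i + (sum (adj G i) + s)) (contractLoops-loopless i) ⟩
    2 * weight G i + (sum (adj G i) + 0)                   ≡⟨ cong (2 * weight G i +_) (+-identityʳ (sum (adj G i))) ⟩
    charge G i                                             ∎
    where
    open ≡-Reasoning
    regroup : ∀ a h s → 2 * (a + h) + s ≡ 2 * a + (s + 2 * h)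
    regroup = solve-∀

  contractLoops-admissible : Admissible g C
  contractLoops-admissible = record
    { symmetric = λ i j → cong₂ (λ d a → (1 ∸ d) * a) (δ-sym i j) (symmetric good i j)
    ; connected = λ i j → Star-collapse (λ i → i) (λ i j i~j i≢j → subst (0 <_) (sym (adj-contractLoops i≢j)) i~j) (connected good i j)
    ; charge≥3 = λ i → subst (3 ≤_) (sym (charge-contractLoops i)) (charge≥3 good i)
    ; genus = trans (cong (_+ 2) (sum-cong-≗ charge-contractLoops)) (genus good)
    }

-- ls gives the number of loops at each vertex, at the expense of its weight.
attachLoops : Table n → Vec ℕ n → Table n
attachLoops (table ws rs) ls = table (Vec.zipWith _∸_ ws ls)
  (Vec.zipWith (λ i r → updateAt r i (λ _ → 2 * lookup ls i)) (allFin _) rs)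

-- With the total weight as budget for the sum, only the entrywise bounds restrict the numbers of
-- loops.
loopings : Table n → List (Table n)
loopings T = List.map (attachLoops T) (boxes (weights T) (Vec.sum (weights T)))

sum-mono-≤ : ∀ {f h : Fin n → ℕ} → (∀ i → f i ≤ h i) → sum f ≤ sum h
sum-mono-≤ {zero} _ = z≤n
sum-mono-≤ {suc n} f≤h = +-mono-≤ (f≤h zero) (sum-mono-≤ (f≤h ∘ suc))

loopings-complete : ∀ (G : Graph n) → EvenDiagonal G → ∀ T → Represents (contractLoops G) T → Any (Represents G) (loopings T)
loopings-complete {n} G even T C≅T =
  lose (∈-map⁺ (attachLoops T) (∈-boxes (weights T) ls (Vec.sum (weights T)) ls≤ws
         (subst₂ _≤_ (sym (Vec-sum≡sum ls)) (sym (Vec-sum≡sum (weights T))) (sum-mono-≤ ls≤ws))))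
       (iso π weight-eq adj-eq)
  where
  π : Permutation n n
  π = perm C≅T
  loops : Fin n → ℕ
  loops i = ⌊ adj G i i /2⌋
  ls : Vec ℕ n
  ls = tabulate (λ i → loops (π ⟨$⟩ˡ i))
  lookup-ls : ∀ i → lookup ls (π ⟨$⟩ʳ i) ≡ loops i
  lookup-ls i = trans (Vec.lookup∘tabulate _ (π ⟨$⟩ʳ i)) (cong loops (inverseˡ π))
  ls≤ws : ∀ i → lookup ls i ≤ lookup (weights T) i
  ls≤ws i = subst₂ _≤_ (sym (Vec.lookup∘tabulate _ i))
    (trans (sym (weight≡ C≅T (π ⟨$⟩ˡ i))) (cong (lookup (weights T)) (inverseʳ π)))
    (m≤n+m (loops (π ⟨$⟩ˡ i)) (weight G (π ⟨$⟩ˡ i)))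
  weight-eq : ∀ i → weight ⟦ attachLoops T ls ⟧ (π ⟨$⟩ʳ i) ≡ weight G i
  weight-eq i = trans (Vec.lookup-zipWith _∸_ (π ⟨$⟩ʳ i) (weights T) ls)
    (trans (cong₂ _∸_ (weight≡ C≅T i) (lookup-ls i)) (m+n∸n≡m (weight G i) (loops i)))
  row : Fin n → Vec ℕ n
  row i = updateAt (lookup (rows T) i) i (λ _ → 2 * lookup ls i)
  lookup-row : ∀ i → lookup (rows (attachLoops T ls)) i ≡ row i
  lookup-row i = trans (Vec.lookup-zipWith _ i (allFin n) (rows T))
    (cong (λ k → updateAt (lookup (rows T) i) k (λ _ → 2 * lookup ls k)) (Vec.lookup-allFin i))
  entry : ∀ i j → Dec (i ≡ j) → lookup (row (π ⟨$⟩ʳ i)) (π ⟨$⟩ʳ j) ≡ adj G i j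
  entry i i (yes refl) = trans (Vec.lookup∘updateAt (π ⟨$⟩ʳ i) (lookup (rows T) (π ⟨$⟩ʳ i)))
    (trans (cong (2 *_) (lookup-ls i)) (sym (even i)))
  entry i j (no i≢j) = trans (Vec.lookup∘updateAt′ (π ⟨$⟩ʳ j) (π ⟨$⟩ʳ i) (i≢j ∘ sym ∘ permute-injective π) (lookup (rows T) (π ⟨$⟩ʳ i)))
    (trans (adj≡ C≅T i j) (trans (cong (λ d → (1 ∸ d) * adj G i j) (δ-distinct i≢j)) (*-identityˡ (adj G i j))))
  adj-eq : ∀ i j → adj ⟦ attachLoops T ls ⟧ (π ⟨$⟩ʳ i) (π ⟨$⟩ʳ j) ≡ adj G i j
  adj-eq i j = trans (cong (λ r → lookup r (π ⟨$⟩ʳ j)) (lookup-row (π ⟨$⟩ʳ i))) (entry i j (i Fin.≟ j))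

Lists : ℕ → List (Table n) → Set
Lists {n} g Ts = ∀ (G : Graph n) → Admissible g G → EvenDiagonal G → Any (Represents G) Ts

loopings-list : ∀ {g} {Ts : List (Table n)} → ListsLoopless g Ts → Lists g (dedupe (List.concatMap loopings Ts))
loopings-list complete G good even = dedupe-complete (Any.concatMap⁺ loopings (Any.map (λ {T} → loopings-complete G even T)
  (complete (contractLoops G) (contractLoops-admissible G good even) (contractLoops-loopless G good even))))

-- Enumeration and counting

Class : Set
Class = ∃ λ n → Table (suc n)

RepresentsClass : Graph m → Class → Set
RepresentsClass G (_ , T) = Represents G T

-- Starting from the loopless types with n + 1 vertices, all types with n + 1, …, n + d vertices.
classesFrom : ℕ → List (Table (suc n)) → List Class
classesFrom zero Ts = []
classesFrom {n} (suc d) Ts =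
  List.map (n ,_) (dedupe (List.concatMap loopings Ts)) ++ classesFrom d (dedupe (List.concatMap splits Ts))

vertexOfWeight : ℕ → Table 1
vertexOfWeight g = table (g ∷ []) ((0 ∷ []) ∷ [])

classes : ℕ → List Class
classes g = classesFrom (2 * g ∸ 2) (vertexOfWeight g ∷ [])

-- Each round of splitting adds one vertex, so the types with `m + 1` vertices are listed after
-- `m - n` rounds.
classesFrom-complete : ∀ {g} d (Ts : List (Table (suc n))) → ListsLoopless g Ts → n ≤ m → m < d + n →
  ∀ (G : Graph (suc m)) → Admissible g G → EvenDiagonal G → Any (RepresentsClass G) (classesFrom d Ts)
classesFrom-complete zero Ts complete n≤m m<n = contradiction n≤m (<⇒≱ m<n)
classesFrom-complete {n} {m} (suc d) Ts complete n≤m m<d+n G good even = by-size (n ≟ m)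
  where
  by-size : Dec (n ≡ m) → Any (RepresentsClass G) (classesFrom (suc d) Ts)
  by-size (yes refl) = Any.++⁺ˡ (Any.map⁺ (loopings-list complete G good even))
  by-size (no n≢m) = Any.++⁺ʳ (List.map (n ,_) (dedupe (List.concatMap loopings Ts)))
    (classesFrom-complete d (dedupe (List.concatMap splits Ts)) (splits-complete complete)
      (≤∧≢⇒< n≤m n≢m) (subst (m <_) (sym (+-suc d n)) m<d+n) G good even)

-- The charge of a single vertex without loops is twice its weight, and the genus equation makes it
-- `2g`.
vertex-complete : ∀ g → ListsLoopless g (vertexOfWeight g ∷ [])
vertex-complete g G good loopless = here (≗⇒≅
  (λ { zero → sym (*-cancelˡ-≡ (weight G zero) g 2 weight-zero) })
  (λ { zero zero → sym (loopless zero) }))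
  where
  weight-zero : 2 * weight G zero ≡ 2 * g
  weight-zero = +-cancelʳ-≡ 2 _ _ (trans (cong (_+ 2) (sym total)) (genus good))
    where
    total : sum (charge G) ≡ 2 * weight G zero
    total = trans (+-identityʳ _) (trans (cong (λ a → 2 * weight G zero + (a + 0)) (loopless zero)) (+-identityʳ _))

-- All charges are at least 3 and they add up to `2g - 2 + 2n`, so `3n` is at most that. This is the
-- depth used in `classes`.
size-bound : ∀ {g} (G : Graph n) → Admissible g G → n ≤ 2 * g ∸ 2
size-bound {n} {g} G good = m+n≤o⇒m≤o∸n n (+-cancelʳ-≤ (2 * n) (n + 2) (2 * g) (begin
  n + 2 + 2 * n                 ≡⟨ regroup n ⟩
  n * 3 + 2                     ≡⟨ cong (_+ 2) (sum-threes n) ⟨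
  sum {n} (λ _ → 3) + 2         ≤⟨ +-monoˡ-≤ 2 (sum-mono-≤ (charge≥3 good)) ⟩
  sum (charge G) + 2            ≡⟨ genus good ⟩
  2 * g + 2 * n                 ∎))
  where
  open ≤-Reasoning
  regroup : ∀ n → n + 2 + 2 * n ≡ n * 3 + 2
  regroup = solve-∀
  sum-threes : ∀ k → sum {k} (λ _ → 3) ≡ k * 3
  sum-threes zero = refl
  sum-threes (suc k) = cong (3 +_) (sum-threes k)

classes-complete : ∀ {g} (G : Graph n) → 1 ≤ n → Admissible g G → EvenDiagonal G → Any (RepresentsClass G) (classes g)
classes-complete {suc n} {g} G _ good even = classesFrom-complete (2 * g ∸ 2) (vertexOfWeight g ∷ []) (vertex-complete g)
  z≤n (subst (n <_) (sym (+-identityʳ (2 * g ∸ 2))) (size-bound G good)) G good even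

-- Checking that a listed table is a type.

lookup-transpose : ∀ {A : Set} (xss : Vec (Vec A n) m) i j →
  lookup (lookup (Vec.transpose xss) j) i ≡ lookup (lookup xss i) j
lookup-transpose {n = n} {A = A} (_∷_ {n = m} xs xss) i j = trans (cong (λ v → lookup v i) column) (at i)
  where
  cons : A → Vec A m → Vec A (suc m)
  cons = _∷_
  column : lookup (Vec.transpose (xs ∷ xss)) j ≡ lookup xs j ∷ lookup (Vec.transpose xss) j
  column = trans (Vec.lookup-⊛ j (Vec.replicate n cons Vec.⊛ xs) (Vec.transpose xss))
    (trans (cong (λ (f : Vec A m → Vec A (suc m)) → f (lookup (Vec.transpose xss) j)) (Vec.lookup-⊛ j (Vec.replicate n cons) xs))
      (cong (λ (f : A → Vec A m → Vec A (suc m)) → f (lookup xs j) (lookup (Vec.transpose xss) j)) (Vec.lookup-replicate j cons)))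
  at : ∀ i → lookup (lookup xs j ∷ lookup (Vec.transpose xss) j) i ≡ lookup (lookup (xs ∷ xss) i) j
  at zero = refl
  at (suc i) = lookup-transpose xss i j

-- A certificate that can be tested by evaluation. Connectedness is replaced by `earlier`, the
-- property that the labelling by `order` aims at. The base value 3 of the minimum does not affect
-- the comparison with 3.
record Valid (g : ℕ) (T : Table (suc n)) : Set where
  constructor valid
  field
    symmetricT : Bool.T (Vec.transpose (rows T) ≡ᵐ rows T)
    evenT      : EvenDiagonal ⟦ T ⟧
    earlier    : ∀ i → ∃ λ j → toℕ j < suc (toℕ i) × 0 < adj ⟦ T ⟧ (suc i) j
    charges≥3  : 3 ≤ minimum 3 (charges T)
    genusT     : Vec.sum (charges T) + 2 ≡ 2 * g + 2 * suc n

  valid-symmetric : ∀ i j → adj ⟦ T ⟧ i j ≡ adj ⟦ T ⟧ j i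
  valid-symmetric i j = trans (sym (lookup-transpose (rows T) i j)) (cong (λ rs → lookup (lookup rs j) i) (≡ᵐ⇒≡ (Vec.transpose (rows T)) (rows T) symmetricT))

open Valid

valid? : ∀ g (T : Table (suc n)) → Dec (Valid g T)
valid? {n} g T = map′ (λ (s , e , c , t , γ) → valid s e c t γ) (λ v → symmetricT v , evenT v , earlier v , charges≥3 v , genusT v)
  ( T? (Vec.transpose (rows T) ≡ᵐ rows T)
  ×-dec Fin.all? (λ i → adj ⟦ T ⟧ i i ≟ 2 * ⌊ adj ⟦ T ⟧ i i /2⌋)
  ×-dec Fin.all? (λ i → Fin.any? (λ j → toℕ j <? suc (toℕ i) ×-dec 0 <? adj ⟦ T ⟧ (suc i) j))
  ×-dec 3 ≤? minimum 3 (charges T)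
  ×-dec Vec.sum (charges T) + 2 ≟ 2 * g + 2 * suc n)

minimum-≤ : ∀ t (xs : Vec ℕ n) i → minimum t xs ≤ lookup xs i
minimum-≤ t (x ∷ xs) zero = m⊓n≤m x _
minimum-≤ t (x ∷ xs) (suc i) = ≤-trans (m⊓n≤n x _) (minimum-≤ t xs i)

valid⇒admissible : ∀ {g} (T : Table (suc n)) → Valid g T → Admissible g ⟦ T ⟧
valid⇒admissible {n} {g} T v = record
  { symmetric = valid-symmetric v
  -- Both vertices descend to `zero` through neighbours of smaller index, and symmetry lets the
  -- second path be reversed.
  ; connected = λ i j → to-zero i (<-wellFounded (toℕ i)) ◅◅ Star.reverse (subst (0 <_) (valid-symmetric v _ _)) (to-zero j (<-wellFounded (toℕ j)))
  ; charge≥3 = λ i → subst (3 ≤_) (lookup-charges T i) (≤-trans (charges≥3 v) (minimum-≤ 3 (charges T) i))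
  ; genus = trans (cong (_+ 2) (sym (trans (Vec-sum≡sum (charges T)) (sum-cong-≗ (lookup-charges T))))) (genusT v)
  }
  where
  to-zero : ∀ i → Acc _<_ (toℕ i) → Star (Adjacent ⟦ T ⟧) i zero
  to-zero zero _ = ε
  to-zero (suc i) (acc smaller) with earlier v i
  ... | j , j<i , i~j = i~j ◅ to-zero j (smaller j<i)

-- Counting isomorphism classes from a verified list.

typeOf : Class → WGraph
typeOf (_ , T) = realise ⟦ T ⟧

keyOfClass : Class → ℕ
keyOfClass (_ , T) = key T

module _ {A : Set} (type : A → WGraph) (label : A → ℕ) where

  lookup-injective : ∀ xs → AllPairs (λ x y → label x < label y) xs →
    ∀ i j → label (List.lookup xs i) ≡ label (List.lookup xs j) → i ≡ j
  lookup-injective (x ∷ xs) (x<xs ∷ rest) zero zero eq = refl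
  lookup-injective (x ∷ xs) (x<xs ∷ rest) zero (suc j) eq = contradiction eq (<⇒≢ (All.lookup x<xs (∈-lookup j)))
  lookup-injective (x ∷ xs) (x<xs ∷ rest) (suc i) zero eq = contradiction (sym eq) (<⇒≢ (All.lookup x<xs (∈-lookup i)))
  lookup-injective (x ∷ xs) (x<xs ∷ rest) (suc i) (suc j) eq = cong suc (lookup-injective xs rest i j eq)

  -- Labels increase strictly along the list and agree on isomorphic types, so different positions
  -- hold non-isomorphic types and the positions index the classes.
  numIsoClasses : ∀ (P : WGraph → Set) (xs : List A) →
    AllPairs (λ x y → label x < label y) xs →
    (∀ {x y} → x ∈ xs → y ∈ xs → Iso (type x) (type y) → label x ≡ label y) →
    (∀ {x} → x ∈ xs → P (type x)) →
    (∀ G → P G → ∃ λ x → x ∈ xs × Iso G (type x)) →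
    NumIsoClasses P (List.length xs)
  numIsoClasses P xs increasing invariant holds complete =
    (type ∘ List.lookup xs) ,
    (λ i → holds (∈-lookup i)) ,
    (λ i j i≅j → lookup-injective xs increasing i j (invariant (∈-lookup i) (∈-lookup j) i≅j)) ,
    λ G p → position (complete G p)
    where
    position : ∀ {G} → (∃ λ x → x ∈ xs × Iso G (type x)) → ∃ λ i → Iso G (type (List.lookup xs i))
    position {G} (x , x∈xs , G≅x) = Any.index x∈xs , subst (λ y → Iso G (type y)) (Any.lookup-index x∈xs) G≅x

edgeCount : Class → ℕ
edgeCount (_ , T) = ⌊ Vec.sum (Vec.map Vec.sum (rows T)) /2⌋

edgeCount≡nE : ∀ (C : Class) → ⟦ proj₂ C ⟧ ≅ graphOf (typeOf C) → edgeCount C ≡ nE (typeOf C)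
edgeCount≡nE (n , T) C≅ = trans (cong ⌊_/2⌋ (begin
  Vec.sum (Vec.map Vec.sum (rows T))                        ≡⟨ Vec-sum≡sum (Vec.map Vec.sum (rows T)) ⟩
  sum (lookup (Vec.map Vec.sum (rows T)))                   ≡⟨ sum-cong-≗ (λ i → trans (Vec.lookup-map i Vec.sum (rows T)) (Vec-sum≡sum (lookup (rows T) i))) ⟩
  sum (λ i → sum (adj ⟦ T ⟧ i))                             ≡⟨ sum-cong-≗ (λ i → sum-adj i) ⟨
  sum (λ i → sum (adj (graphOf G) (π ⟨$⟩ʳ i)))              ≡⟨ sum-permute (λ i → sum (adj (graphOf G) i)) π ⟨
  sum (λ i → sum (adj (graphOf G) i))                       ≡⟨ handshake G ⟩
  2 * nE G                                                  ≡⟨ cong (nE G +_) (+-identityʳ (nE G)) ⟩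
  nE G + nE G                                               ∎)) (sym (n≡⌊n+n/2⌋ (nE G)))
  where
  open ≡-Reasoning
  G = realise ⟦ T ⟧
  π = perm C≅
  sum-adj : ∀ i → sum (adj (graphOf G) (π ⟨$⟩ʳ i)) ≡ sum (adj ⟦ T ⟧ i)
  sum-adj i = trans (sum-permute (adj (graphOf G) (π ⟨$⟩ʳ i)) π) (sum-cong-≗ (adj≡ C≅ i))

countOf : ℕ → List ℕ → ℕ
countOf e es = List.length (List.filter (_≟ e) es)

countsMatch? : ∀ {m} (fs : Vec ℕ m) es → Dec (∀ e → countOf (toℕ e) es ≡ lookup fs e)
countsMatch? fs es = Fin.all? (λ e → countOf (toℕ e) es ≟ lookup fs e)

-- Combining the decisions with _∧_ rather than _×-dec_ lets the evaluated parts be discarded.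
verify : ∀ {m} → ℕ → ℕ → Vec ℕ m → List Class → Bool
verify g total fs Ts =
  does (All.all? (valid? g ∘ proj₂) Ts) ∧
  does (linked? _<?_ (List.map keyOfClass Ts)) ∧
  does (List.length Ts ≟ total) ∧
  does (countsMatch? fs (List.map edgeCount Ts))

does-∧ : ∀ {P : Set} (d : Dec P) {b} → does d ∧ b ≡ true → P × b ≡ true
does-∧ (yes p) eq = p , eq

countOf-map : ∀ {A : Set} (f : A → ℕ) e xs → countOf e (List.map f xs) ≡ List.length (List.filter (λ x → f x ≟ e) xs)
countOf-map f e [] = refl
countOf-map f e (x ∷ xs) with does (f x ≟ e)
... | true = cong suc (countOf-map f e xs)
... | false = countOf-map f e xs

module _ {m} g (2≤g : 2 ≤ g) total (fs : Vec ℕ m) (verified : verify g total fs (classes g) ≡ true) where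

  private
    Ts = classes g

    valid×     = does-∧ (All.all? (valid? g ∘ proj₂) Ts) verified
    linked×    = does-∧ (linked? _<?_ (List.map keyOfClass Ts)) (proj₂ valid×)
    length×    = does-∧ (List.length Ts ≟ total) (proj₂ linked×)
    -- The last test of `verify` has no further conjunct, so a `true` is appended to give it the
    -- form that `does-∧` expects.
    counts×    = does-∧ (countsMatch? fs (List.map edgeCount Ts)) (trans (Bool.∧-identityʳ _) (proj₂ length×))

    all-valid : ∀ {T} → T ∈ Ts → Valid g (proj₂ T)
    all-valid = All.lookup (proj₁ valid×)

    increasing : AllPairs (λ S T → keyOfClass S < keyOfClass T) Ts
    increasing = AllPairs.map⁻ (Linked⇒AllPairs <-trans (proj₁ linked×))

    realised : ∀ {T} → T ∈ Ts → ⟦ proj₂ T ⟧ ≅ graphOf (typeOf T)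
    realised {_ , T} T∈Ts = graphOf-realise ⟦ T ⟧ (valid-symmetric v) (evenT v)
      where v = all-valid T∈Ts

    invariant : ∀ {S T} → S ∈ Ts → T ∈ Ts → Iso (typeOf S) (typeOf T) → keyOfClass S ≡ keyOfClass T
    invariant {S} {T} S∈Ts T∈Ts S≅T = sym (key-invariant {S = proj₂ S} {T = proj₂ T}
      (≅-trans (realised S∈Ts) (≅-trans (Iso⇒≅ (typeOf S) (typeOf T) S≅T) (≅-sym (realised T∈Ts)))))

    holds : ∀ {T} → T ∈ Ts → TypeOfGenus g (typeOf T)
    holds {_ , T} T∈Ts = admissible⇒typeOfGenus (realise ⟦ T ⟧) (s≤s z≤n)
      (admissible-≅ (realised T∈Ts) (valid⇒admissible T (all-valid T∈Ts)))

    complete : ∀ G → TypeOfGenus g G → ∃ λ T → T ∈ Ts × Iso G (typeOf T)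
    complete G type@(((nonempty , _) , _) , _) =
      represented (find (classes-complete (graphOf G) nonempty (typeOfGenus⇒admissible 2≤g G type) (evenDiagonal-graphOf G)))
      where
      represented : (∃ λ T → T ∈ Ts × RepresentsClass (graphOf G) T) → ∃ λ T → T ∈ Ts × Iso G (typeOf T)
      represented (T , T∈Ts , G≅T) = T , T∈Ts , ≅⇒Iso G (typeOf T) (≅-trans G≅T (realised T∈Ts))

    withEdges : ℕ → List Class
    withEdges e = List.filter (λ T → edgeCount T ≟ e) Ts

    ∈-withEdges : ∀ e {T} → T ∈ withEdges e → T ∈ Ts × edgeCount T ≡ e
    ∈-withEdges e = ∈-filter⁻ (λ T → edgeCount T ≟ e)

    complete-withEdges : ∀ e G → TypeOfGenusEdges g e G → ∃ λ T → T ∈ withEdges e × Iso G (typeOf T)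
    complete-withEdges e G (type , nE≡e) = counted (complete G type)
      where
      counted : (∃ λ T → T ∈ Ts × Iso G (typeOf T)) → ∃ λ T → T ∈ withEdges e × Iso G (typeOf T)
      counted (T , T∈Ts , G≅T) = T ,
        ∈-filter⁺ (λ T → edgeCount T ≟ e) T∈Ts
          (trans (edgeCount≡nE T (realised T∈Ts)) (trans (sym (Perm.↔⇒≡ (proj₁ (proj₂ G≅T)))) nE≡e)) , G≅T

  counts : Counts g total m fs
  counts =
    subst (NumIsoClasses (TypeOfGenus g)) (proj₁ length×)
      (numIsoClasses typeOf keyOfClass (TypeOfGenus g) Ts increasing invariant holds complete) ,
    λ e → subst (NumIsoClasses (TypeOfGenusEdges g (toℕ e)))
      (trans (sym (countOf-map edgeCount (toℕ e) Ts)) (proj₁ counts× e))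
      (numIsoClasses typeOf keyOfClass (TypeOfGenusEdges g (toℕ e)) (withEdges (toℕ e))
        (AllPairs.filter⁺ (λ T → edgeCount T ≟ toℕ e) increasing)
        (λ S∈ T∈ → invariant (proj₁ (∈-withEdges (toℕ e) S∈)) (proj₁ (∈-withEdges (toℕ e) T∈)))
        (λ {T} T∈ → holds (proj₁ (∈-withEdges (toℕ e) T∈)) ,
                trans (sym (edgeCount≡nE T (realised (proj₁ (∈-withEdges (toℕ e) T∈))))) (proj₂ (∈-withEdges (toℕ e) T∈)))
        (complete-withEdges (toℕ e)))

-- Genus 3, 4 and 5, by evaluating the enumeration and its tests.

genus3 : Vec ℕ 7
genus3 = 1 ∷ 2 ∷ 5 ∷ 9 ∷ 12 ∷ 8 ∷ 5 ∷ []

genus4 : Vec ℕ 10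
genus4 = 1 ∷ 3 ∷ 7 ∷ 21 ∷ 43 ∷ 75 ∷ 89 ∷ 81 ∷ 42 ∷ 17 ∷ []

genus5 : Vec ℕ 13
genus5 = 1 ∷ 3 ∷ 11 ∷ 34 ∷ 100 ∷ 239 ∷ 492 ∷ 784 ∷ 1002 ∷ 926 ∷ 632 ∷ 260 ∷ 71 ∷ []

verified3 : verify 3 42 genus3 (classes 3) ≡ true
verified3 = refl

verified4 : verify 4 379 genus4 (classes 4) ≡ true
verified4 = refl

verified5 : verify 5 4555 genus5 (classes 5) ≡ true
verified5 = refl

theorem2p12 : Counts 3 42 7 (1 ∷ 2 ∷ 5 ∷ 9 ∷ 12 ∷ 8 ∷ 5 ∷ [])
    × Counts 4 379 10 (1 ∷ 3 ∷ 7 ∷ 21 ∷ 43 ∷ 75 ∷ 89 ∷ 81 ∷ 42 ∷ 17 ∷ [])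
    × Counts 5 4555 13 (1 ∷ 3 ∷ 11 ∷ 34 ∷ 100 ∷ 239 ∷ 492 ∷ 784 ∷ 1002 ∷ 926 ∷ 632 ∷ 260 ∷ 71 ∷ [])
theorem2p12 =
  counts 3 (s≤s (s≤s z≤n)) 42 genus3 verified3 ,
  counts 4 (s≤s (s≤s z≤n)) 379 genus4 verified4 ,
  counts 5 (s≤s (s≤s z≤n)) 4555 genus5 verified5
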